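{- Every piecewise-linear function $\varphi:\mathbb{R}^d\to\mathbb{R}$ is a (finite, real) linear combination of conewise linear functions $\mathbb{R}^d\to\mathbb{R}$, where distinct conewise linear functions in the combination may have their cones originate from distinct points.
   Context: A piecewise-linear function is a continuous function $\mathbb{R}^d\to\mathbb{R}$ for which there is a finite cover of $\mathbb{R}^d$ by polyhedra on each of which the function is affine; equivalently, a difference of two functions of the form $\max_{1\le i\le n}(\langle b_i,x\rangle+a_i)$ with $a_i\in\mathbb{R}$, $b_i\in\mathbb{R}^d$. A conewise linear function is a piecewise-linear function for which there are a point $p\in\mathbb{R}^d$ and finitely many polyhedral cones with apex $p$ (translates by $p$ of polyhedral cones at the origin) covering $\mathbb{R}^d$ such that the function is affine on each of these cones. -}

module Defs where

open import Level using (0ℓ) renaming (suc to lsuc)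
open import Data.Nat.Base using (ℕ)
open import Data.List.Base using (List)
open import Data.List.Relation.Unary.All using (All)
open import Data.List.Relation.Unary.Any using (Any)
open import Data.Product.Base using (_×_; _,_; ∃; ∃-syntax)
open import Data.Vec.Functional using (Vector; zipWith)
open import Relation.Nullary.Negation.Core using (¬_)
open import Relation.Unary using (Pred)
open import Relation.Binary.Core using (Rel)
open import Relation.Binary.Bundles using (TotalOrder)
open import Relation.Binary.Structures using (IsTotalOrder)
open import Algebra.Bundles using (CommutativeRing)
open import Algebra.Core using (Op₁; Op₂)
open import Algebra.Structures using (IsCommutativeRing)
import Algebra.Construct.NaturalChoice.Max as Max
import Algebra.Properties.CommutativeMonoid.Sum as Sum
import Relation.Binary.Properties.TotalOrder as TotalOrderProperties

-- The real numbers, axiomatised as a Dedekind-complete ordered field.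
-- Classically these axioms determine ℝ up to unique isomorphism.
record RealField : Set (lsuc 0ℓ) where
  infix  8 -_
  infixl 7 _*_
  infixl 6 _+_
  infix  4 _≈_ _≤_
  field
    Carrier           : Set
    _≈_               : Rel Carrier 0ℓ
    _≤_               : Rel Carrier 0ℓ
    _+_               : Op₂ Carrier
    _*_               : Op₂ Carrier
    -_                : Op₁ Carrier
    0#                : Carrier
    1#                : Carrier
    isCommutativeRing : IsCommutativeRing _≈_ _+_ _*_ -_ 0# 1#
    isTotalOrder      : IsTotalOrder _≈_ _≤_
    0≉1               : ¬ (0# ≈ 1#)
    inverse           : ∀ x → ¬ (x ≈ 0#) → ∃[ y ] x * y ≈ 1#
    +-monoˡ-≤         : ∀ {x y} z → x ≤ y → x + z ≤ y + z
    *-nonNeg          : ∀ {x y} → 0# ≤ x → 0# ≤ y → 0# ≤ x * y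

  UpperBound : Pred Carrier 0ℓ → Carrier → Set
  UpperBound S u = ∀ x → S x → x ≤ u

  field
    supremum : (S : Pred Carrier 0ℓ) → ∃ S → ∃ (UpperBound S) →
               ∃[ s ] UpperBound S s × (∀ u → UpperBound S u → s ≤ u)

  commutativeRing : CommutativeRing 0ℓ 0ℓ
  commutativeRing = record { isCommutativeRing = isCommutativeRing }

  totalOrder : TotalOrder 0ℓ 0ℓ 0ℓ
  totalOrder = record { isTotalOrder = isTotalOrder }

  open CommutativeRing commutativeRing public
    using (_-_; +-commutativeMonoid)
  open TotalOrderProperties totalOrder public using (_<_)
  open Max totalOrder public using (_⊔_)
  open Sum +-commutativeMonoid public using (sum)

  ∣_∣ : Carrier → Carrier
  ∣ x ∣ = x ⊔ - x

module PiecewiseLinearity (ℝ : RealField) where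
  open RealField ℝ

  ℝ^ : ℕ → Set
  ℝ^ d = Vector Carrier d

  ⟨_,_⟩ : ∀ {d} → ℝ^ d → ℝ^ d → Carrier
  ⟨ b , x ⟩ = sum (zipWith _*_ b x)

  -- Continuity for the maximum norm, which induces the usual topology.
  -- It implies that φ respects pointwise _≈_.
  Continuous : ∀ {d} → (ℝ^ d → Carrier) → Set
  Continuous {d} φ =
    ∀ (x : ℝ^ d) ε → 0# < ε →
    ∃[ δ ] 0# < δ ×
      (∀ (y : ℝ^ d) → (∀ i → ∣ y i - x i ∣ < δ) → ∣ φ y - φ x ∣ < ε)

  AffineOn : ∀ {d} → Pred (ℝ^ d) 0ℓ → (ℝ^ d → Carrier) → Set
  AffineOn {d} P φ =
    ∃[ b ] ∃[ a ] (∀ (x : ℝ^ d) → P x → φ x ≈ ⟨ b , x ⟩ + a)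

  -- The pair (b , a) stands for the closed half-space ⟨ b , x ⟩ ≤ a.
  Polyhedron : ℕ → Set
  Polyhedron d = List (ℝ^ d × Carrier)

  infix 4 _∈ₚ_
  _∈ₚ_ : ∀ {d} → ℝ^ d → Polyhedron d → Set
  x ∈ₚ P = All (λ (b , a) → ⟨ b , x ⟩ ≤ a) P

  -- A polyhedral cone at the origin: b stands for the half-space
  -- ⟨ b , x ⟩ ≤ 0.
  Cone : ℕ → Set
  Cone d = List (ℝ^ d)

  infix 4 _∈ᶜ_
  _∈ᶜ_ : ∀ {d} → ℝ^ d → Cone d → Set
  x ∈ᶜ C = All (λ b → ⟨ b , x ⟩ ≤ 0#) C

  _∈_+ᶜ_ : ∀ {d} → ℝ^ d → ℝ^ d → Cone d → Set
  x ∈ p +ᶜ C = zipWith _-_ x p ∈ᶜ C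

  PiecewiseLinear : ∀ {d} → (ℝ^ d → Carrier) → Set
  PiecewiseLinear {d} φ =
    Continuous φ ×
    ∃[ Ps ] (∀ (x : ℝ^ d) → Any (x ∈ₚ_) Ps) ×
            All (λ P → AffineOn (_∈ₚ P) φ) Ps

  ConewiseLinear : ∀ {d} → (ℝ^ d → Carrier) → Set
  ConewiseLinear {d} φ =
    PiecewiseLinear φ ×
    ∃[ p ] ∃[ Cs ] (∀ (x : ℝ^ d) → Any (λ C → x ∈ p +ᶜ C) Cs) ×
                   All (λ C → AffineOn (λ x → x ∈ p +ᶜ C) φ) Cs

  IsLinearCombination : ∀ {d n} → (ℝ^ d → Carrier) →
                        Vector Carrier n → Vector (ℝ^ d → Carrier) n → Set
  IsLinearCombination {d} φ c ψ =
    ∀ (x : ℝ^ d) → φ x ≈ sum (λ i → c i * ψ i x)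

{-# OPTIONS --safe #-}
module Submission where

-- A continuous φ that selects from finitely many affine functions fᵢ satisfies,
-- for all x and y, fᵢ(x) ≤ φ(x) and φ(y) ≤ fᵢ(y) for some i. Hence φ is a maximum
-- of minima of the fᵢ, and so a difference of two maxima of affine functions. A
-- maximum of affine functions is conewise linear if they all agree at some point.
-- Otherwise elimination yields weights wᵢ, not all zero, with ∑ wᵢ = 0 and
-- ∑ wᵢ fᵢ constant, without loss of generality ≤ 0. Then the fᵢ with wᵢ > 0 never
-- all exceed the remaining ones, and inclusion-exclusion over them writes the
-- maximum as a signed sum of maxima of fewer functions.

open import Defs
open import Level using (0ℓ)
open import Data.Nat.Base as ℕ using (ℕ; zero; suc)
import Data.Nat.Properties as ℕₚ
open import Data.Integer.Base as ℤ using (ℤ; +_; -[1+_]; _⊖_)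
import Data.Integer.Properties as ℤₚ
open import Data.Maybe.Base as Maybe using (Maybe)
open import Data.Product.Base using (_×_; _,_; proj₁; proj₂; ∃-syntax; Σ-syntax)
open import Data.Sum.Base using (_⊎_; inj₁; inj₂; [_,_]′)
open import Data.Vec.Functional as Vector using (Vector; zipWith)
open import Data.List.Base as List using (List; []; _∷_; _ʳ++_)
open import Data.List.Relation.Unary.All as All using (All; []; _∷_)
open import Data.List.Relation.Unary.Any as Any using (Any; here; there)
open import Data.List.Membership.Propositional using (_∈_; find; lose)
open import Data.List.Membership.Propositional.Properties
  using (∈-filter⁺; ∈-++⁺ˡ; ∈-++⁺ʳ; ∈-++⁻; ∈-map⁺; ∈-allFin)
open import Data.List.Properties using (map-++; length-++; map-tabulate; tabulate-lookup)
open import Data.List.Relation.Unary.All.Properties using (all-filter; ++⁺; ¬Any⇒All¬)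
  renaming (map⁺ to All-map⁺; map⁻ to All-map⁻)
open import Data.List.Relation.Unary.Any.Properties using (lookup-index) renaming (map⁺ to Any-map⁺)
open import Data.List.Relation.Binary.Permutation.Propositional
  using (_↭_; prep; ↭-refl; ↭-sym; ↭-trans; ↭-reflexive)
open import Data.List.Relation.Binary.Permutation.Propositional.Properties
  using (All-resp-↭; ∈-resp-↭; ↭-length; shift; ++↭ʳ++) renaming (map⁺ to ↭-map⁺)
open import Data.Bool.Base using (true; false)
open import Relation.Unary using (Pred; Decidable)
open import Function.Base using (_∘_; id)
open import Axiom.ExcludedMiddle using (ExcludedMiddle)
open import Relation.Nullary using (¬_; yes; no; does; contradiction)
open import Relation.Nullary.Decidable using (dec⇒maybe)
open import Relation.Binary.PropositionalEquality as ≡ using (_≡_)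
open import Algebra.Bundles using (CommutativeRing)
open import Data.Fin.Base using (Fin; zero; suc)
open import Relation.Binary.Bundles using (TotalOrder)
import Algebra.Construct.NaturalChoice.Max as Max
import Algebra.Properties.Semiring.Sum as Sums
import Relation.Binary.Construct.NonStrictToStrict as ToStrict
import Relation.Binary.Properties.TotalOrder as TotalOrderProperties

-- Integer coefficients have decidable equality, which the solver needs in order
-- to cancel x - x; equality in R itself is not decidable.
module IntegerCoefficientSolver (R : CommutativeRing 0ℓ 0ℓ) where
  open CommutativeRing R
  open import Algebra.Properties.Ring ring
  open import Algebra.Properties.AbelianGroup +-abelianGroup using (⁻¹-∙-comm)
  open import Algebra.Properties.Semiring.Mult.TCOptimised semiring
    using (×-homo-+; ×1-homo-*) renaming (_×_ to _·_)
  open import Algebra.Solver.Ring.AlmostCommutativeRing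
    using (_-Raw-AlmostCommutative⟶_; fromCommutativeRing)
  open import Relation.Binary.Reasoning.Setoid setoid
  open import Algebra.Properties.CommutativeSemigroup
    (CommutativeRing.+-commutativeSemigroup R) using (interchange)

  ⟦_⟧ : ℤ → Carrier
  ⟦ + n ⟧      = n · 1#
  ⟦ -[1+ n ] ⟧ = - (suc n · 1#)

  ⟦⟧-⊖ : ∀ m n → ⟦ m ⊖ n ⟧ ≈ m · 1# - n · 1#
  ⟦⟧-⊖ m zero = sym (trans (+-congˡ -0#≈0#) (+-identityʳ _))
  ⟦⟧-⊖ zero (suc n) = sym (+-identityˡ _)
  ⟦⟧-⊖ (suc m) (suc n) = begin
    ⟦ suc m ⊖ suc n ⟧                   ≡⟨ ≡.cong ⟦_⟧ (ℤₚ.[1+m]⊖[1+n]≡m⊖n m n) ⟩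
    ⟦ m ⊖ n ⟧                           ≈⟨ ⟦⟧-⊖ m n ⟩
    m · 1# - n · 1#                     ≈⟨ +-identityˡ _ ⟨
    0# + (m · 1# - n · 1#)              ≈⟨ +-congʳ (-‿inverseʳ 1#) ⟨
    1# - 1# + (m · 1# - n · 1#)         ≈⟨ interchange _ _ _ _ ⟩
    1# + m · 1# + (- 1# - n · 1#)       ≈⟨ +-congˡ (⁻¹-∙-comm _ _) ⟩
    1# + m · 1# - (1# + n · 1#)         ≈⟨ +-cong (×-homo-+ 1# 1 m) (-‿cong (×-homo-+ 1# 1 n)) ⟨
    suc m · 1# - suc n · 1#             ∎

  ⟦⟧-neg : ∀ i → ⟦ ℤ.- i ⟧ ≈ - ⟦ i ⟧
  ⟦⟧-neg (+ zero)    = sym -0#≈0#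
  ⟦⟧-neg (+ (suc n)) = refl
  ⟦⟧-neg -[1+ n ]    = sym (-‿involutive _)

  ⟦⟧-+ : ∀ i j → ⟦ i ℤ.+ j ⟧ ≈ ⟦ i ⟧ + ⟦ j ⟧
  ⟦⟧-+ (+ m) (+ n)           = ×-homo-+ 1# m n
  ⟦⟧-+ (+ m) -[1+ n ]        = ⟦⟧-⊖ m (suc n)
  ⟦⟧-+ -[1+ m ] (+ n)        = trans (⟦⟧-⊖ n (suc m)) (+-comm _ _)
  ⟦⟧-+ -[1+ m ] -[1+ n ]     = begin
    - (suc (suc (m ℕ.+ n)) · 1#)         ≡⟨ ≡.cong (λ k → - (k · 1#)) (ℕₚ.+-suc (suc m) n) ⟨
    - ((suc m ℕ.+ suc n) · 1#)           ≈⟨ -‿cong (×-homo-+ 1# (suc m) (suc n)) ⟩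
    - (suc m · 1# + suc n · 1#)          ≈⟨ ⁻¹-∙-comm _ _ ⟨
    - (suc m · 1#) - (suc n · 1#)        ∎

  ⟦⟧-*-pos : ∀ m j → ⟦ + m ℤ.* j ⟧ ≈ ⟦ + m ⟧ * ⟦ j ⟧
  ⟦⟧-*-pos m (+ n) = trans (reflexive (≡.cong ⟦_⟧ (≡.sym (ℤₚ.pos-* m n)))) (×1-homo-* m n)
  ⟦⟧-*-pos m -[1+ n ] = begin
    ⟦ + m ℤ.* -[1+ n ] ⟧         ≡⟨ ≡.cong ⟦_⟧ (ℤₚ.neg-distribʳ-* (+ m) (+ suc n)) ⟨
    ⟦ ℤ.- (+ m ℤ.* + suc n) ⟧    ≈⟨ ⟦⟧-neg (+ m ℤ.* + suc n) ⟩
    - ⟦ + m ℤ.* + suc n ⟧        ≈⟨ -‿cong (⟦⟧-*-pos m (+ suc n)) ⟩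
    - (m · 1# * (suc n · 1#))    ≈⟨ -‿distribʳ-* _ _ ⟩
    m · 1# * - (suc n · 1#)      ∎

  ⟦⟧-* : ∀ i j → ⟦ i ℤ.* j ⟧ ≈ ⟦ i ⟧ * ⟦ j ⟧
  ⟦⟧-* (+ m) j = ⟦⟧-*-pos m j
  ⟦⟧-* -[1+ m ] j = begin
    ⟦ -[1+ m ] ℤ.* j ⟧         ≡⟨ ≡.cong ⟦_⟧ (ℤₚ.neg-distribˡ-* (+ suc m) j) ⟨
    ⟦ ℤ.- (+ suc m ℤ.* j) ⟧    ≈⟨ ⟦⟧-neg (+ suc m ℤ.* j) ⟩
    - ⟦ + suc m ℤ.* j ⟧        ≈⟨ -‿cong (⟦⟧-*-pos (suc m) j) ⟩
    - (suc m · 1# * ⟦ j ⟧)     ≈⟨ -‿distribˡ-* _ _ ⟩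
    - (suc m · 1#) * ⟦ j ⟧     ∎

  morphism : ℤ.+-*-rawRing -Raw-AlmostCommutative⟶ fromCommutativeRing R
  morphism = record
    { ⟦_⟧ = ⟦_⟧ ; +-homo = ⟦⟧-+ ; *-homo = ⟦⟧-* ; -‿homo = ⟦⟧-neg
    ; 0-homo = refl ; 1-homo = refl }

  open import Algebra.Solver.Ring ℤ.+-*-rawRing (fromCommutativeRing R) morphism
    (λ i j → Maybe.map (λ i≡j → reflexive (≡.cong ⟦_⟧ i≡j)) (dec⇒maybe (i ℤₚ.≟ j))) public
    using (solve; con; _:+_; _:*_; _:-_; :-_; _:=_)

-- The max-min formula arises as follows. For each `y`, take the pieces that are at least `φ` at
-- `y`: their minimum is at least `φ y` at `y`, and the inequalities for this `y` and every `x` keep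
-- it below `φ` everywhere. Only finitely many sets of pieces occur. The inequalities themselves are
-- one-dimensional, on the segment from `x` to `y`, and follow by continuous induction; this is
-- where completeness enters. The obstacle after that is that the pieces of a maximum meet at many
-- different points, so that no single apex serves. If the linear parts of the differences with one
-- fixed piece are independent, a point where all pieces agree can be solved for. Otherwise a
-- dependence among the differences is available, and giving the fixed piece the opposite total
-- weight makes the weights sum to zero. Excluded middle decides comparisons of reals, and also
-- quantified statements such as whether the minimum of a set of pieces stays below `φ`.

module Decomposition (em : ExcludedMiddle 0ℓ) (ℝ : RealField) where
  open RealField ℝ
  open PiecewiseLinearity ℝ
  open CommutativeRing commutativeRing
    using (refl; sym; trans; reflexive; setoid; semiring; +-cong; +-congˡ; +-congʳ; +-comm;
           +-identityˡ; +-identityʳ; *-congˡ; *-congʳ; *-comm; *-identityʳ;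
           zeroˡ; zeroʳ; -‿cong; -‿inverseʳ)
  open TotalOrder totalOrder using (poset; total; antisym)
    renaming (refl to ≤-refl; trans to ≤-trans; reflexive to ≤-reflexive;
              ≤-respˡ-≈ to ≤-respˡ; ≤-respʳ-≈ to ≤-respʳ)
  open TotalOrderProperties totalOrder using (≰⇒>; <⇒≱; <-respˡ-≈; <-respʳ-≈)
  open ToStrict _≈_ _≤_ using (<⇒≤)
  open Max totalOrder
    using (x≤x⊔y; x≤y⊔x; ⊔-lub; ⊔-sel; ⊔-cong; ⊔-assoc; mono-≤-distrib-⊔; x≤y⇒x⊔y≈y)
  open Sums semiring using (sum-cong-≋; ∑-distrib-+; *-distribʳ-sum; sum-replicate-zero)
  open IntegerCoefficientSolver commutativeRing hiding (morphism)
  open import Relation.Binary.Reasoning.PartialOrder poset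

  -- Ordered field arithmetic

  ≮⇒≥ : ∀ {x y} → ¬ (x < y) → y ≤ x
  ≮⇒≥ {x} {y} x≮y with em {y ≤ x}
  ... | yes y≤x = y≤x
  ... | no y≰x  = contradiction (≰⇒> y≰x) x≮y

  <-≤-trans : ∀ {x y z} → x < y → y ≤ z → x < z
  <-≤-trans {x} {y} {z} x<y y≤z = begin-strict x <⟨ x<y ⟩ y ≤⟨ y≤z ⟩ z ∎

  ≤-<-trans : ∀ {x y z} → x ≤ y → y < z → x < z
  ≤-<-trans {x} {y} {z} x≤y y<z = begin-strict x ≤⟨ x≤y ⟩ y <⟨ y<z ⟩ z ∎

  x≤y⇒0≤y-x : ∀ {x y} → x ≤ y → 0# ≤ y - x
  x≤y⇒0≤y-x {x} {y} x≤y = begin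
    0#     ≈⟨ -‿inverseʳ x ⟨
    x - x  ≤⟨ +-monoˡ-≤ (- x) x≤y ⟩
    y - x  ∎

  ≤-by : ∀ {x y z} → 0# ≤ z → y - x ≈ z → x ≤ y
  ≤-by {x} {y} {z} 0≤z y-x≈z = begin
    x           ≈⟨ +-identityˡ x ⟨
    0# + x      ≤⟨ +-monoˡ-≤ x 0≤z ⟩
    z + x       ≈⟨ +-congʳ y-x≈z ⟨
    y - x + x   ≈⟨ solve 2 (λ x y → y :- x :+ x := y) refl x y ⟩
    y           ∎

  x<y⇒0<y-x : ∀ {x y} → x < y → 0# < y - x
  x<y⇒0<y-x {x} {y} (x≤y , x≉y) = x≤y⇒0≤y-x x≤y , λ 0≈y-x → x≉y (begin-equality
    x             ≈⟨ +-identityˡ x ⟨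
    0# + x        ≈⟨ +-congʳ 0≈y-x ⟩
    y - x + x     ≈⟨ solve 2 (λ x y → y :- x :+ x := y) refl x y ⟩
    y             ∎)

  <-by : ∀ {x y z} → 0# < z → y - x ≈ z → x < y
  <-by {x} {y} (0≤z , 0≉z) y-x≈z = ≤-by 0≤z y-x≈z , λ x≈y → 0≉z
    (trans (trans (sym (-‿inverseʳ x)) (+-congʳ x≈y)) y-x≈z)

  +-nonNeg : ∀ {x y} → 0# ≤ x → 0# ≤ y → 0# ≤ x + y
  +-nonNeg {x} {y} 0≤x 0≤y = begin
    0#      ≤⟨ 0≤y ⟩
    y       ≈⟨ +-identityˡ y ⟨
    0# + y  ≤⟨ +-monoˡ-≤ y 0≤x ⟩
    x + y   ∎

  +-posˡ : ∀ {x y} → 0# < x → 0# ≤ y → 0# < x + y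
  +-posˡ {x} {y} 0<x 0≤y = <-≤-trans 0<x
    (≤-by 0≤y (solve 2 (λ x y → x :+ y :- x := y) refl x y))

  +-posʳ : ∀ {x y} → 0# ≤ x → 0# < y → 0# < x + y
  +-posʳ {x} {y} 0≤x 0<y = <-respʳ-≈ (+-comm y x) (+-posˡ 0<y 0≤x)

  +-pos : ∀ {x y} → 0# < x → 0# < y → 0# < x + y
  +-pos 0<x 0<y = +-posˡ 0<x (<⇒≤ 0<y)

  *-pos : ∀ {x y} → 0# < x → 0# < y → 0# < x * y
  *-pos {x} {y} (0≤x , 0≉x) (0≤y , 0≉y) = *-nonNeg 0≤x 0≤y , λ 0≈xy →
    let x⁻¹ , xx⁻¹≈1 = inverse x (λ x≈0 → 0≉x (sym x≈0)) in
    0≉y (begin-equality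
      0#             ≈⟨ zeroʳ x⁻¹ ⟨
      x⁻¹ * 0#       ≈⟨ *-congˡ 0≈xy ⟩
      x⁻¹ * (x * y)  ≈⟨ solve 3 (λ x y z → z :* (x :* y) := y :* (x :* z)) refl x y x⁻¹ ⟩
      y * (x * x⁻¹)  ≈⟨ *-congˡ xx⁻¹≈1 ⟩
      y * 1#         ≈⟨ *-identityʳ y ⟩
      y              ∎)

  0≤-x : ∀ {x} → x ≤ 0# → 0# ≤ - x
  0≤-x {x} x≤0 = ≤-respʳ (+-identityˡ (- x)) (x≤y⇒0≤y-x x≤0)

  0<-x : ∀ {x} → x < 0# → 0# < - x
  0<-x {x} x<0 = <-respʳ-≈ (+-identityˡ (- x)) (x<y⇒0<y-x x<0)

  neg-mono-≤ : ∀ {x y} → x ≤ y → - y ≤ - x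
  neg-mono-≤ {x} {y} x≤y = ≤-by (x≤y⇒0≤y-x x≤y)
    (solve 2 (λ x y → :- x :- (:- y) := y :- x) refl x y)

  0<1 : 0# < 1#
  0<1 with total 0# 1#
  ... | inj₁ 0≤1 = 0≤1 , 0≉1
  ... | inj₂ 1≤0 = ≤-respʳ (solve 0 (:- con (+ 1) :* (:- con (+ 1)) := con (+ 1)) refl)
                     (*-nonNeg (0≤-x 1≤0) (0≤-x 1≤0)) , 0≉1

  inverse-pos : ∀ {x} → 0# < x → ∃[ y ] 0# < y × x * y ≈ 1#
  inverse-pos {x} (0≤x , 0≉x) with inverse x (λ x≈0 → 0≉x (sym x≈0))
  ... | y , xy≈1 = y , ≰⇒> y≰0 , xy≈1
    where
    y≰0 : ¬ (y ≤ 0#)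
    y≰0 y≤0 = <⇒≱ 0<1 (≤-by (*-nonNeg 0≤x (0≤-x y≤0)) (begin-equality
      0# - 1#     ≈⟨ +-congˡ (-‿cong xy≈1) ⟨
      0# - x * y  ≈⟨ solve 2 (λ x y → con (+ 0) :- x :* y := x :* (:- y)) refl x y ⟩
      x * - y     ∎))

  halve : ∀ ε → 0# < ε → ∃[ η ] 0# < η × η + η ≈ ε
  halve ε 0<ε = let ½ , 0<½ , 2½≈1 = inverse-pos (+-pos 0<1 0<1) in
    ε * ½ , *-pos 0<ε 0<½ , (begin-equality
    ε * ½ + ε * ½       ≈⟨ solve 2 (λ ε h → ε :* h :+ ε :* h := ε :* ((con (+ 1) :+ con (+ 1)) :* h)) refl ε ½ ⟩
    ε * ((1# + 1#) * ½) ≈⟨ *-congˡ 2½≈1 ⟩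
    ε * 1#              ≈⟨ *-identityʳ ε ⟩
    ε                   ∎)

  lower-pos : ∀ {x y} → 0# < x → 0# < y → ∃[ z ] 0# < z × z ≤ x × z ≤ y
  lower-pos {x} {y} 0<x 0<y with total x y
  ... | inj₁ x≤y = x , 0<x , ≤-refl , x≤y
  ... | inj₂ y≤x = y , 0<y , y≤x , ≤-refl

  ⊔-lub-< : ∀ {x y z} → x < z → y < z → x ⊔ y < z
  ⊔-lub-< {x} {y} x<z y<z with ⊔-sel x y
  ... | inj₁ eq = <-respˡ-≈ (sym eq) x<z
  ... | inj₂ eq = <-respˡ-≈ (sym eq) y<z

  ∣x∣<ε⇒x<ε : ∀ {x ε} → ∣ x ∣ < ε → x < ε
  ∣x∣<ε⇒x<ε {x} = ≤-<-trans (x≤x⊔y x (- x))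

  ∣x∣<ε⇒-x<ε : ∀ {x ε} → ∣ x ∣ < ε → - x < ε
  ∣x∣<ε⇒-x<ε {x} = ≤-<-trans (x≤y⊔x x (- x))

  ∣∣-cong : ∀ {x y} → x ≈ y → ∣ x ∣ ≈ ∣ y ∣
  ∣∣-cong x≈y = ⊔-cong x≈y (-‿cong x≈y)

  ∣x-x∣<ε : ∀ {x y ε} → 0# < ε → x ≈ y → ∣ x - y ∣ < ε
  ∣x-x∣<ε {x} {y} 0<ε x≈y = ⊔-lub-<
    (<-respˡ-≈ (sym x-y≈0) 0<ε)
    (<-respˡ-≈ (sym (trans (-‿cong x-y≈0) (solve 0 (:- con (+ 0) := con (+ 0)) refl))) 0<ε)
    where
    x-y≈0 : x - y ≈ 0#
    x-y≈0 = trans (+-congʳ x≈y) (-‿inverseʳ y)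

  sum-nonNeg : ∀ {n} (t : Vector Carrier n) → (∀ i → 0# ≤ t i) → 0# ≤ sum t
  sum-nonNeg {zero}  t 0≤t = ≤-refl
  sum-nonNeg {suc n} t 0≤t = +-nonNeg (0≤t zero) (sum-nonNeg (λ i → t (suc i)) (λ i → 0≤t (suc i)))

  sum-pos : ∀ {n} (t : Vector Carrier n) → (∀ i → 0# ≤ t i) → ∀ i → 0# < t i → 0# < sum t
  sum-pos t 0≤t zero    0<tᵢ =
    +-posˡ 0<tᵢ (sum-nonNeg (λ i → t (suc i)) (λ i → 0≤t (suc i)))
  sum-pos t 0≤t (suc i) 0<tᵢ =
    +-posʳ (0≤t zero) (sum-pos (λ i → t (suc i)) (λ i → 0≤t (suc i)) i 0<tᵢ)

  -- Continuity

  Near : ∀ {d} → Carrier → ℝ^ d → ℝ^ d → Set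
  Near δ x y = ∀ i → ∣ y i - x i ∣ < δ

  Near-weaken : ∀ {d δ δ′} {x y : ℝ^ d} → δ ≤ δ′ → Near δ x y → Near δ′ x y
  Near-weaken δ≤δ′ near i = <-≤-trans (near i) δ≤δ′

  Near-≋ : ∀ {d δ} {x y : ℝ^ d} → 0# < δ → (∀ i → y i ≈ x i) → Near δ x y
  Near-≋ 0<δ y≈x i = ∣x-x∣<ε 0<δ (y≈x i)

  continuous-const : ∀ {d} c → Continuous {d} (λ _ → c)
  continuous-const c x ε 0<ε = 1# , 0<1 , λ _ _ → ∣x-x∣<ε 0<ε refl

  continuous-≈ : ∀ {d} {f g : ℝ^ d → Carrier} → (∀ x → f x ≈ g x) → Continuous f → Continuous g
  continuous-≈ f≈g cont x ε 0<ε = let δ , 0<δ , bound = cont x ε 0<ε in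
    δ , 0<δ , λ y near → <-respˡ-≈ (∣∣-cong (+-cong (f≈g y) (-‿cong (f≈g x)))) (bound y near)

  continuous-+ : ∀ {d} {f g : ℝ^ d → Carrier} →
                 Continuous f → Continuous g → Continuous (λ x → f x + g x)
  continuous-+ {f = f} {g} contᶠ contᵍ x ε 0<ε =
    let η , 0<η , η+η≈ε   = halve ε 0<ε
        δᶠ , 0<δᶠ , boundᶠ = contᶠ x η 0<η
        δᵍ , 0<δᵍ , boundᵍ = contᵍ x η 0<η
        δ , 0<δ , δ≤δᶠ , δ≤δᵍ = lower-pos 0<δᶠ 0<δᵍ
    in δ , 0<δ , λ y near →
      let ∣f∣<η = boundᶠ y (Near-weaken δ≤δᶠ near)
          ∣g∣<η = boundᵍ y (Near-weaken δ≤δᵍ near)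
      in ⊔-lub-<
        (add η+η≈ε
          (solve 4 (λ a b c d → a :+ b :- (c :+ d) := (a :- c) :+ (b :- d)) refl
            (f y) (g y) (f x) (g x))
          (∣x∣<ε⇒x<ε ∣f∣<η) (∣x∣<ε⇒x<ε ∣g∣<η))
        (add η+η≈ε
          (solve 4 (λ a b c d → :- (a :+ b :- (c :+ d)) := (:- (a :- c)) :+ (:- (b :- d))) refl
            (f y) (g y) (f x) (g x))
          (∣x∣<ε⇒-x<ε ∣f∣<η) (∣x∣<ε⇒-x<ε ∣g∣<η))
    where
    add : ∀ {u v w η} → η + η ≈ ε → w ≈ u + v → u < η → v < η → w < ε
    add {u} {v} {w} {η} η+η≈ε w≈u+v u<η v<η =
      <-respˡ-≈ (sym w≈u+v) (<-respʳ-≈ η+η≈ε (<-by (+-pos (x<y⇒0<y-x u<η) (x<y⇒0<y-x v<η))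
        (solve 3 (λ u v η → η :+ η :- (u :+ v) := (η :- u) :+ (η :- v)) refl u v η)))

  -- The radius is `ε` divided by `1# + ∣ c ∣`; the summand `1#` keeps the divisor positive when `c`
  -- vanishes and makes the final bound strict.
  scaled-small : ∀ c ε → 0# < ε → ∃[ δ ] 0# < δ × (∀ u → ∣ u ∣ < δ → ∣ c * u ∣ < ε)
  scaled-small c ε 0<ε = let y , 0<y , [1+∣c∣]y≈1 = inverse-pos 0<1+∣c∣ in
    ε * y , *-pos 0<ε 0<y , λ u ∣u∣<δ → bounds y 0<y [1+∣c∣]y≈1 u ∣u∣<δ (total 0# c)
    where
    0≤∣c∣ : 0# ≤ ∣ c ∣
    0≤∣c∣ with total 0# c
    ... | inj₁ 0≤c = ≤-trans 0≤c (x≤x⊔y c (- c))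
    ... | inj₂ c≤0 = ≤-trans (0≤-x c≤0) (x≤y⊔x c (- c))

    0<1+∣c∣ : 0# < 1# + ∣ c ∣
    0<1+∣c∣ = +-posˡ 0<1 0≤∣c∣

    module _ (y : Carrier) (0<y : 0# < y) ([1+∣c∣]y≈1 : (1# + ∣ c ∣) * y ≈ 1#) where
      -- The one-sided estimate to which all signs reduce: `a` is whichever of `c` and `- c` is
      -- nonnegative, and `v` is `u` or `- u`.
      half : ∀ {a v w} → 0# ≤ a → a ≤ ∣ c ∣ → v < ε * y → a * v ≈ w → w < ε
      half {a} {v} {w} 0≤a a≤∣c∣ v<εy av≈w = <-by
        (+-posˡ (*-pos (*-pos 0<ε 0<y) (+-posˡ 0<1 (x≤y⇒0≤y-x a≤∣c∣)))
                (*-nonNeg 0≤a (<⇒≤ (x<y⇒0<y-x v<εy))))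
        (begin-equality
          ε - w
            ≈⟨ +-cong (trans (*-congˡ [1+∣c∣]y≈1) (*-identityʳ ε)) (-‿cong av≈w) ⟨
          ε * ((1# + ∣ c ∣) * y) - a * v
            ≈⟨ solve 5 (λ ε y C a v → ε :* ((con (+ 1) :+ C) :* y) :- a :* v
                 := (ε :* y) :* (con (+ 1) :+ (C :- a)) :+ a :* (ε :* y :- v)) refl ε y ∣ c ∣ a v ⟩
          (ε * y) * (1# + (∣ c ∣ - a)) + a * (ε * y - v) ∎)

      bounds : ∀ u → ∣ u ∣ < ε * y → 0# ≤ c ⊎ c ≤ 0# → ∣ c * u ∣ < ε
      bounds u ∣u∣<δ (inj₁ 0≤c) = ⊔-lub-<
        (half 0≤c (x≤x⊔y c (- c)) (∣x∣<ε⇒x<ε ∣u∣<δ) refl)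
        (half 0≤c (x≤x⊔y c (- c)) (∣x∣<ε⇒-x<ε ∣u∣<δ)
          (solve 2 (λ c u → c :* (:- u) := :- (c :* u)) refl c u))
      bounds u ∣u∣<δ (inj₂ c≤0) = ⊔-lub-<
        (half (0≤-x c≤0) (x≤y⊔x c (- c)) (∣x∣<ε⇒-x<ε ∣u∣<δ)
          (solve 2 (λ c u → (:- c) :* (:- u) := c :* u) refl c u))
        (half (0≤-x c≤0) (x≤y⊔x c (- c)) (∣x∣<ε⇒x<ε ∣u∣<δ)
          (solve 2 (λ c u → (:- c) :* u := :- (c :* u)) refl c u))

  scaled-small-∀ : ∀ {d} (v : ℝ^ d) ε → 0# < ε →
                   ∃[ δ ] 0# < δ × (∀ u → ∣ u ∣ < δ → ∀ i → ∣ v i * u ∣ < ε)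
  scaled-small-∀ {zero}  v ε 0<ε = 1# , 0<1 , λ _ _ ()
  scaled-small-∀ {suc d} v ε 0<ε =
    let δ₀ , 0<δ₀ , bound₀ = scaled-small (v zero) ε 0<ε
        δ₁ , 0<δ₁ , bound₁ = scaled-small-∀ (λ i → v (suc i)) ε 0<ε
        δ , 0<δ , δ≤δ₀ , δ≤δ₁ = lower-pos 0<δ₀ 0<δ₁
    in δ , 0<δ , λ where
      u ∣u∣<δ zero    → bound₀ u (<-≤-trans ∣u∣<δ δ≤δ₀)
      u ∣u∣<δ (suc i) → bound₁ u (<-≤-trans ∣u∣<δ δ≤δ₁) i

  continuous-* : ∀ {d} {f : ℝ^ d → Carrier} c → Continuous f → Continuous (λ x → c * f x)
  continuous-* {f = f} c cont x ε 0<ε =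
    let η , 0<η , small = scaled-small c ε 0<ε
        δ , 0<δ , bound = cont x η 0<η
    in δ , 0<δ , λ y near → <-respˡ-≈
      (∣∣-cong (solve 3 (λ c a b → c :* (a :- b) := c :* a :- c :* b) refl c (f y) (f x)))
      (small (f y - f x) (bound y near))

  continuous-- : ∀ {d} {f g : ℝ^ d → Carrier} →
                 Continuous f → Continuous g → Continuous (λ x → f x - g x)
  continuous-- {f = f} {g} contᶠ contᵍ =
    continuous-≈ (λ x → solve 2 (λ a b → a :+ (:- con (+ 1)) :* b := a :- b) refl (f x) (g x))
      (continuous-+ contᶠ (continuous-* (- 1#) contᵍ))

  -- The larger of `a` and `b` is compared with its own primed partner, which is at most `a′ ⊔ b′`.
  ⊔-diff-< : ∀ {a b a′ b′ ε} → a - a′ < ε → b - b′ < ε → a ⊔ b - (a′ ⊔ b′) < ε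
  ⊔-diff-< {a} {b} {a′} {b′} {ε} a-a′<ε b-b′<ε with ⊔-sel a b
  ... | inj₁ eq = ≤-<-trans
    (≤-by (x≤y⇒0≤y-x (x≤x⊔y a′ b′)) (begin-equality
      a - a′ - (a ⊔ b - (a′ ⊔ b′))  ≈⟨ +-congˡ (-‿cong (+-congʳ eq)) ⟩
      a - a′ - (a - (a′ ⊔ b′))
        ≈⟨ solve 3 (λ a a′ m → a :- a′ :- (a :- m) := m :- a′) refl a a′ (a′ ⊔ b′) ⟩
      (a′ ⊔ b′) - a′                  ∎)) a-a′<ε
  ... | inj₂ eq = ≤-<-trans
    (≤-by (x≤y⇒0≤y-x (x≤y⊔x a′ b′)) (begin-equality
      b - b′ - (a ⊔ b - (a′ ⊔ b′))  ≈⟨ +-congˡ (-‿cong (+-congʳ eq)) ⟩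
      b - b′ - (b - (a′ ⊔ b′))
        ≈⟨ solve 3 (λ a a′ m → a :- a′ :- (a :- m) := m :- a′) refl b b′ (a′ ⊔ b′) ⟩
      (a′ ⊔ b′) - b′                  ∎)) b-b′<ε

  continuous-⊔ : ∀ {d} {f g : ℝ^ d → Carrier} →
                 Continuous f → Continuous g → Continuous (λ x → f x ⊔ g x)
  continuous-⊔ {f = f} {g} contᶠ contᵍ x ε 0<ε =
    let δᶠ , 0<δᶠ , boundᶠ = contᶠ x ε 0<ε
        δᵍ , 0<δᵍ , boundᵍ = contᵍ x ε 0<ε
        δ , 0<δ , δ≤δᶠ , δ≤δᵍ = lower-pos 0<δᶠ 0<δᵍ
    in δ , 0<δ , λ y near →
      let ∣f∣<ε = boundᶠ y (Near-weaken δ≤δᶠ near)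
          ∣g∣<ε = boundᵍ y (Near-weaken δ≤δᵍ near)
      in ⊔-lub-<
        (⊔-diff-< (∣x∣<ε⇒x<ε ∣f∣<ε) (∣x∣<ε⇒x<ε ∣g∣<ε))
        (<-respˡ-≈ (-[x-y] _ _) (⊔-diff-<
          (<-respˡ-≈ (sym (-[x-y] _ _)) (∣x∣<ε⇒-x<ε ∣f∣<ε))
          (<-respˡ-≈ (sym (-[x-y] _ _)) (∣x∣<ε⇒-x<ε ∣g∣<ε))))
    where
    -[x-y] : ∀ x y → x - y ≈ - (y - x)
    -[x-y] = solve 2 (λ x y → x :- y := :- (y :- x)) refl

  continuous-⟨⟩ : ∀ {d} (b : ℝ^ d) → Continuous ⟨ b ,_⟩
  continuous-⟨⟩ {zero}  b = continuous-const 0#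
  continuous-⟨⟩ {suc d} b = continuous-+
    (continuous-* (b zero) (λ x ε 0<ε → ε , 0<ε , λ y near → near zero))
    (λ x ε 0<ε →
      let δ , 0<δ , bound = continuous-⟨⟩ (λ i → b (suc i)) (λ i → x (suc i)) ε 0<ε
      in δ , 0<δ , λ y near → bound (λ i → y (suc i)) (λ i → near (suc i)))

  -- The premise `f x < g x` comes after the radius, so that a radius exists whether or not it
  -- holds. `persists` can then take one radius for both directions and all pieces.
  continuous-< : ∀ {d} {f g : ℝ^ d → Carrier} → Continuous f → Continuous g → ∀ x →
                 ∃[ δ ] 0# < δ × (∀ y → Near δ x y → f x < g x → f y < g y)
  continuous-< {f = f} {g} contᶠ contᵍ x with em {f x < g x}
  ... | no fx≮gx  = 1# , 0<1 , λ _ _ fx<gx → contradiction fx<gx fx≮gx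
  ... | yes fx<gx =
    let δ , 0<δ , bound = continuous-- contᵍ contᶠ x (g x - f x) (x<y⇒0<y-x fx<gx)
    in δ , 0<δ , λ y near _ → <-by
      (x<y⇒0<y-x (∣x∣<ε⇒-x<ε (bound y near)))
      (solve 4 (λ a b c d → a :- b := c :- d :- (:- (a :- b :- (c :- d)))) refl (g y) (f y) (g x) (f x))

  -- Coordinatewise equal points lie in every neighbourhood of each other, so a strict gap between
  -- the values contradicts continuity with that gap as tolerance.
  continuous-cong : ∀ {d} {f : ℝ^ d → Carrier} → Continuous f →
                    ∀ {x y} → (∀ i → y i ≈ x i) → f x ≈ f y
  continuous-cong {f = f} cont {x} {y} y≈x = antisym (half y≈x) (half (λ i → sym (y≈x i)))
    where
    half : ∀ {x y} → (∀ i → y i ≈ x i) → f x ≤ f y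
    half {x} {y} y≈x = ≮⇒≥ λ fy<fx →
      let _ , 0<δ , bound = cont x (f x - f y) (x<y⇒0<y-x fy<fx)
      in <⇒≱ (∣x∣<ε⇒-x<ε (bound y (Near-≋ 0<δ y≈x)))
           (≤-reflexive (solve 2 (λ a b → a :- b := :- (b :- a)) refl (f x) (f y)))

  -- Affine functions and continuous selections

  ⟨⟩-affineʳ : ∀ {d} (b x z : ℝ^ d) t → ⟨ b , (λ i → x i + t * z i) ⟩ ≈ ⟨ b , x ⟩ + t * ⟨ b , z ⟩
  ⟨⟩-affineʳ {zero} b x z t = solve 1 (λ t → con (+ 0) := con (+ 0) :+ t :* con (+ 0)) refl t
  ⟨⟩-affineʳ {suc d} b x z t = begin-equality
    b zero * (x zero + t * z zero) + ⟨ b ∘ suc , (λ i → x (suc i) + t * z (suc i)) ⟩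
      ≈⟨ +-congˡ (⟨⟩-affineʳ (b ∘ suc) (x ∘ suc) (z ∘ suc) t) ⟩
    b zero * (x zero + t * z zero) + (⟨ b ∘ suc , x ∘ suc ⟩ + t * ⟨ b ∘ suc , z ∘ suc ⟩)
      ≈⟨ solve 6 (λ b x z t X Z → b :* (x :+ t :* z) :+ (X :+ t :* Z)
           := b :* x :+ X :+ t :* (b :* z :+ Z)) refl
           (b zero) (x zero) (z zero) t ⟨ b ∘ suc , x ∘ suc ⟩ ⟨ b ∘ suc , z ∘ suc ⟩ ⟩
    ⟨ b , x ⟩ + t * ⟨ b , z ⟩ ∎

  ⟨⟩-comm : ∀ {d} (b x : ℝ^ d) → ⟨ b , x ⟩ ≈ ⟨ x , b ⟩
  ⟨⟩-comm b x = sum-cong-≋ (λ i → *-comm (b i) (x i))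

  ⟨⟩-congʳ : ∀ {d} (b : ℝ^ d) {x y : ℝ^ d} → (∀ i → x i ≈ y i) → ⟨ b , x ⟩ ≈ ⟨ b , y ⟩
  ⟨⟩-congʳ b x≈y = sum-cong-≋ (λ i → *-congˡ (x≈y i))

  ⟨⟩-subʳ : ∀ {d} (b x p : ℝ^ d) → ⟨ b , zipWith _-_ x p ⟩ ≈ ⟨ b , x ⟩ - ⟨ b , p ⟩
  ⟨⟩-subʳ b x p = begin-equality
    ⟨ b , zipWith _-_ x p ⟩
      ≈⟨ ⟨⟩-congʳ b (λ i → solve 2 (λ x p → x :- p := x :+ (:- con (+ 1)) :* p) refl (x i) (p i)) ⟩
    ⟨ b , (λ i → x i + - 1# * p i) ⟩
      ≈⟨ ⟨⟩-affineʳ b x p (- 1#) ⟩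
    ⟨ b , x ⟩ + - 1# * ⟨ b , p ⟩
      ≈⟨ solve 2 (λ x p → x :+ (:- con (+ 1)) :* p := x :- p) refl ⟨ b , x ⟩ ⟨ b , p ⟩ ⟩
    ⟨ b , x ⟩ - ⟨ b , p ⟩ ∎

  Aff : ℕ → Set
  Aff d = ℝ^ d × Carrier

  eval : ∀ {d} → Aff d → ℝ^ d → Carrier
  eval (b , a) x = ⟨ b , x ⟩ + a

  infixl 6 _⊕[_]_
  _⊕[_]_ : ∀ {d} → Aff d → Carrier → Aff d → Aff d
  (b , a) ⊕[ r ] (b′ , a′) = (λ i → b i + r * b′ i) , a + r * a′

  eval-⊕ : ∀ {d} (f : Aff d) r g x → eval (f ⊕[ r ] g) x ≈ eval f x + r * eval g x
  eval-⊕ (b , a) r (b′ , a′) x = begin-equality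
    ⟨ (λ i → b i + r * b′ i) , x ⟩ + (a + r * a′)
      ≈⟨ +-congʳ (trans (⟨⟩-comm _ x) (⟨⟩-affineʳ x b b′ r)) ⟩
    ⟨ x , b ⟩ + r * ⟨ x , b′ ⟩ + (a + r * a′)
      ≈⟨ +-congʳ (+-cong (⟨⟩-comm x b) (*-congˡ (⟨⟩-comm x b′))) ⟩
    ⟨ b , x ⟩ + r * ⟨ b′ , x ⟩ + (a + r * a′)
      ≈⟨ solve 5 (λ x y a a′ r → x :+ r :* y :+ (a :+ r :* a′) := x :+ a :+ r :* (y :+ a′)) refl
           ⟨ b , x ⟩ ⟨ b′ , x ⟩ a a′ r ⟩
    ⟨ b , x ⟩ + a + r * (⟨ b′ , x ⟩ + a′) ∎

  continuous-eval : ∀ {d} (f : Aff d) → Continuous (eval f)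
  continuous-eval (b , a) = continuous-+ (continuous-⟨⟩ b) (continuous-const a)

  segment : ∀ {d} → ℝ^ d → ℝ^ d → Carrier → ℝ^ d
  segment x y t i = x i + t * (y i - x i)

  eval-segment : ∀ {d} (f : Aff d) x y t →
                 eval f (segment x y t) ≈ eval f x + t * (eval f y - eval f x)
  eval-segment (b , a) x y t = begin-equality
    ⟨ b , segment x y t ⟩ + a
      ≈⟨ +-congʳ (⟨⟩-affineʳ b x (zipWith _-_ y x) t) ⟩
    ⟨ b , x ⟩ + t * ⟨ b , zipWith _-_ y x ⟩ + a
      ≈⟨ +-congʳ (+-congˡ (*-congˡ (⟨⟩-subʳ b y x))) ⟩
    ⟨ b , x ⟩ + t * (⟨ b , y ⟩ - ⟨ b , x ⟩) + a
      ≈⟨ solve 4 (λ x y t a → x :+ t :* (y :- x) :+ a := x :+ a :+ t :* (y :+ a :- (x :+ a))) refl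
           ⟨ b , x ⟩ ⟨ b , y ⟩ t a ⟩
    ⟨ b , x ⟩ + a + t * (⟨ b , y ⟩ + a - (⟨ b , x ⟩ + a)) ∎

  segment-near : ∀ {d} (x y : ℝ^ d) s ε → 0# < ε →
                 ∃[ δ ] 0# < δ × (∀ t → ∣ t - s ∣ < δ → Near ε (segment x y s) (segment x y t))
  segment-near x y s ε 0<ε =
    let δ , 0<δ , small = scaled-small-∀ (λ i → y i - x i) ε 0<ε
    in δ , 0<δ , λ t ∣t-s∣<δ i → <-respˡ-≈
      (∣∣-cong (solve 4 (λ x v s t → v :* (t :- s) := x :+ t :* v :- (x :+ s :* v)) refl
        (x i) (y i - x i) s t))
      (small (t - s) ∣t-s∣<δ i)

  -- The affine function with value `c + u * m` at `u` cannot have negative slope, since it goes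
  -- from zero at `s` to a positive value at `t`. Its value at zero is therefore at most its value
  -- at `s`.
  slope : ∀ {c m s t} → 0# ≤ s → s ≤ t → c + s * m ≈ 0# → 0# < c + t * m → c ≤ 0#
  slope {c} {m} {s} {t} 0≤s s≤t zero-at-s pos-at-t with total 0# m
  ... | inj₁ 0≤m = ≤-by (*-nonNeg 0≤s 0≤m) (begin-equality
    0# - c              ≈⟨ +-congʳ zero-at-s ⟨
    c + s * m - c       ≈⟨ solve 3 (λ c s m → c :+ s :* m :- c := s :* m) refl c s m ⟩
    s * m               ∎)
  ... | inj₂ m≤0 = contradiction
    (≤-by (*-nonNeg (x≤y⇒0≤y-x s≤t) (0≤-x m≤0)) (begin-equality
      0# - (c + t * m)           ≈⟨ +-congʳ zero-at-s ⟨
      c + s * m - (c + t * m)    ≈⟨ solve 4 (λ c s t m → c :+ s :* m :- (c :+ t :* m)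
                                       := (t :- s) :* (:- m)) refl c s t m ⟩
      (t - s) * - m              ∎))
    (<⇒≱ pos-at-t)

  -- The crossing property of continuous selections

  module Selection {d} (φ : ℝ^ d → Carrier) (φ-continuous : Continuous φ)
                   (fs : List (Aff d)) (φ∈fs : ∀ x → Any (λ f → φ x ≈ eval f x) fs) where

    -- Read contrapositively, a piece that agrees with `φ` at `y` already agrees with it at `x`.
    Persists : ℝ^ d → ℝ^ d → Aff d → Set
    Persists x y f = (eval f x < φ x → eval f y < φ y) × (φ x < eval f x → φ y < eval f y)

    persists : ∀ x (gs : List (Aff d)) →
               ∃[ δ ] 0# < δ × (∀ y → Near δ x y → All (Persists x y) gs)
    persists x []       = 1# , 0<1 , λ _ _ → []
    persists x (g ∷ gs) =
      let δ₁ , 0<δ₁ , below = continuous-< (continuous-eval g) φ-continuous x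
          δ₂ , 0<δ₂ , above = continuous-< φ-continuous (continuous-eval g) x
          δ₃ , 0<δ₃ , rest  = persists x gs
          δ₄ , 0<δ₄ , δ₄≤δ₁ , δ₄≤δ₂ = lower-pos 0<δ₁ 0<δ₂
          δ , 0<δ , δ≤δ₄ , δ≤δ₃ = lower-pos 0<δ₄ 0<δ₃
      in δ , 0<δ , λ y near →
        ( below y (Near-weaken (≤-trans δ≤δ₄ δ₄≤δ₁) near)
        , above y (Near-weaken (≤-trans δ≤δ₄ δ₄≤δ₂) near))
        ∷ rest y (Near-weaken δ≤δ₃ near)

    module Segment (x y : ℝ^ d) where
      ℓ : Carrier → ℝ^ d
      ℓ = segment x y

      -- `Good 1#` is the crossing property once `ℓ 1#` is identified with `y`. It is reached from
      -- `Good 0#` by continuous induction, with a witness that may change along the way.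
      Good : Carrier → Set
      Good t = Any (λ f → eval f x ≤ φ x × φ (ℓ t) ≤ eval f (ℓ t)) fs

      Reached : Carrier → Set
      Reached t = 0# ≤ t × t ≤ 1# × Good t

      ℓ0≈x : ∀ i → ℓ 0# i ≈ x i
      ℓ0≈x i = solve 2 (λ x v → x :+ con (+ 0) :* v := x) refl (x i) (y i - x i)

      ℓ1≈y : ∀ i → ℓ 1# i ≈ y i
      ℓ1≈y i = solve 2 (λ x y → x :+ con (+ 1) :* (y :- x) := y) refl (x i) (y i)

      good-0 : Good 0#
      good-0 = Any.map (λ {f} φ≈f →
        ≤-reflexive (sym (trans (continuous-cong φ-continuous ℓ0≈x)
          (trans φ≈f (sym (continuous-cong (continuous-eval f) ℓ0≈x))))) ,
        ≤-reflexive φ≈f) (φ∈fs (ℓ 0#))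

      reached-0 : Reached 0#
      reached-0 = ≤-refl , <⇒≤ 0<1 , good-0

      PersistsNear : Carrier → Carrier → Set
      PersistsNear s δ = ∀ t → ∣ t - s ∣ < δ → All (Persists (ℓ s) (ℓ t)) fs

      persists-near : ∀ s → ∃[ δ ] 0# < δ × PersistsNear s δ
      persists-near s =
        let ε , 0<ε , persist = persists (ℓ s) fs
            δ , 0<δ , near    = segment-near x y s ε 0<ε
        in δ , 0<δ , λ t ∣t-s∣<δ → persist (ℓ t) (near t ∣t-s∣<δ)

      -- The same piece serves at `s`: if it were strictly below `φ` there, it would still be so at
      -- `t`.
      good-limit : ∀ {s t} → All (Persists (ℓ s) (ℓ t)) fs → Good t → Good s
      good-limit persist good with find good
      ... | f , f∈fs , fx≤φx , φt≤ft = lose f∈fs (fx≤φx ,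
        ≮⇒≥ (λ fs<φs → <⇒≱ (proj₁ (All.lookup persist f∈fs) fs<φs) φt≤ft))

      -- If `s` were not good, no reached point would lie within `δ` of it, and `s - δ` would be a
      -- smaller upper bound.
      good-sup : ∀ {s} → UpperBound Reached s → (∀ u → UpperBound Reached u → s ≤ u) →
                 ∀ {δ} → 0# < δ → PersistsNear s δ → Good s
      good-sup {s} upper least {δ} 0<δ persist with em {Good s}
      ... | yes good = good
      ... | no ¬good = contradiction (least (s - δ) upper′)
        (<⇒≱ (<-by 0<δ (solve 2 (λ s δ → s :- (s :- δ) := δ) refl s δ)))
        where
        upper′ : UpperBound Reached (s - δ)
        upper′ t reached@(_ , _ , good) = ≮⇒≥ λ s-δ<t → ¬good (good-limit (persist t (⊔-lub-<
          (<-by (+-posˡ 0<δ (x≤y⇒0≤y-x (upper t reached)))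
            (solve 3 (λ t s δ → δ :- (t :- s) := δ :+ (s :- t)) refl t s δ))
          (<-by (x<y⇒0<y-x s-δ<t)
            (solve 3 (λ t s δ → δ :- (:- (t :- s)) := t :- (s :- δ)) refl t s δ)))) good)

      -- If the active piece j overtakes f after s, then j is steeper than f and
      -- so lies below f at x.
      overtake : ∀ f j {s t} → 0# ≤ s → s ≤ t → eval j (ℓ s) ≈ eval f (ℓ s) →
                 eval f (ℓ t) < eval j (ℓ t) → eval j x ≤ eval f x
      overtake f j {s} {t} 0≤s s≤t js≈fs ft<jt =
        ≤-by (0≤-x (slope 0≤s s≤t
          (trans (sym (difference s)) (trans (+-congʳ js≈fs) (-‿inverseʳ _)))
          (<-respʳ-≈ (difference t) (x<y⇒0<y-x ft<jt))))
          (solve 2 (λ a b → a :- b := :- (b :- a)) refl (eval f x) (eval j x))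
        where
        difference : ∀ u → eval j (ℓ u) - eval f (ℓ u) ≈
          eval j x - eval f x + u * (eval j y - eval j x - (eval f y - eval f x))
        difference u = trans (+-cong (eval-segment j x y u) (-‿cong (eval-segment f x y u)))
          (solve 5 (λ a b c d u → a :+ u :* b :- (c :+ u :* d) := a :- c :+ u :* (b :- d)) refl
            (eval j x) (eval j y - eval j x) (eval f x) (eval f y - eval f x) u)

      -- The witness `f` has to change only if `φ` touches `f` at `s` and exceeds it at `t`,
      -- following a piece `j`. By persistence `j` is already active at `s`, so it meets `f` there
      -- and `overtake` puts it below `f` at `x`.
      good-extend : ∀ {s t} → 0# ≤ s → s ≤ t → All (Persists (ℓ s) (ℓ t)) fs → Good s → Good t
      good-extend {s} {t} 0≤s s≤t persist good with find good | find (φ∈fs (ℓ t))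
      ... | f , f∈fs , fx≤φx , φs≤fs | j , j∈fs , φt≈jt with em {φ (ℓ s) < eval f (ℓ s)}
      ...   | yes φs<fs = lose f∈fs (fx≤φx , <⇒≤ (proj₂ (All.lookup persist f∈fs) φs<fs))
      ...   | no φs≮fs with em {eval j (ℓ t) ≤ eval f (ℓ t)}
      ...     | yes jt≤ft = lose f∈fs (fx≤φx , ≤-trans (≤-reflexive φt≈jt) jt≤ft)
      ...     | no jt≰ft  = lose j∈fs
        (≤-trans (overtake f j 0≤s s≤t (trans js≈φs φs≈fs) (≰⇒> jt≰ft)) fx≤φx , ≤-reflexive φt≈jt)
        where
        φs≈fs : φ (ℓ s) ≈ eval f (ℓ s)
        φs≈fs = antisym φs≤fs (≮⇒≥ φs≮fs)

        js≈φs : eval j (ℓ s) ≈ φ (ℓ s)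
        js≈φs = antisym
          (≮⇒≥ λ φs<js → <⇒≱ (proj₂ (All.lookup persist j∈fs) φs<js) (≤-reflexive (sym φt≈jt)))
          (≮⇒≥ λ js<φs → <⇒≱ (proj₁ (All.lookup persist j∈fs) js<φs) (≤-reflexive φt≈jt))

      -- The supremum `s` of the reached parameters is good, and goodness spreads over the interval
      -- from `s` to `s + η`. That interval contains `1#`, since otherwise `s + η` would be reached
      -- beyond `s`.
      good-1 : Good 1#
      good-1 =
        let s , upper , least   = supremum Reached (0# , reached-0) (1# , λ _ (_ , t≤1 , _) → t≤1)
            δ , 0<δ , persist   = persists-near s
            -- Half of `δ`, so that the endpoint `s + η` itself is strictly within `δ` of `s`.
            η , 0<η , η+η≈δ     = halve δ 0<δ
            0≤s                 = upper 0# reached-0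
            s≤1                 = least 1# (λ _ (_ , t≤1 , _) → t≤1)
            s≤s+η               = ≤-by (<⇒≤ 0<η) (solve 2 (λ s η → s :+ η :- s := η) refl s η)
            near : ∀ t → s ≤ t → t ≤ s + η → ∣ t - s ∣ < δ
            near t s≤t t≤s+η = ⊔-lub-<
              (<-by (+-posˡ 0<η (x≤y⇒0≤y-x t≤s+η)) (trans (+-congʳ (sym η+η≈δ))
                (solve 3 (λ t s η → η :+ η :- (t :- s) := η :+ (s :+ η :- t)) refl t s η)))
              (<-by (+-posˡ 0<δ (x≤y⇒0≤y-x s≤t))
                (solve 3 (λ t s δ → δ :- (:- (t :- s)) := δ :+ (t :- s)) refl t s δ))
            good : ∀ t → s ≤ t → t ≤ s + η → Good t
            good t s≤t t≤s+η = good-extend 0≤s s≤t (persist t (near t s≤t t≤s+η))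
              (good-sup upper least 0<δ persist)
        in [ (λ s+η≤1 → contradiction
               (upper (s + η) (≤-trans 0≤s s≤s+η , s+η≤1 , good (s + η) s≤s+η ≤-refl))
               (<⇒≱ (<-by 0<η (solve 2 (λ s η → s :+ η :- s := η) refl s η))))
           , good 1# s≤1 ]′ (total (s + η) 1#)

    crossing : ∀ x y → Any (λ f → eval f x ≤ φ x × φ y ≤ eval f y) fs
    crossing x y = Any.map
      (λ {f} (fx≤φx , φ≤f) → fx≤φx , ≤-respˡ (sym (continuous-cong φ-continuous ℓ1≈y))
        (≤-respʳ (sym (continuous-cong (continuous-eval f) ℓ1≈y)) φ≤f)) good-1
      where open Segment x y

  -- Maxima of affine functions

  -- The separate argument `f` keeps the maximum nonempty. As `f` is the innermost operand, adding a
  -- piece to the list is `⊔` with that piece by definition, on which the inclusion-exclusion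
  -- relies.
  mx : ∀ {d} → Aff d → List (Aff d) → ℝ^ d → Carrier
  mx f []       x = eval f x
  mx f (g ∷ gs) x = eval g x ⊔ mx f gs x

  mx-ub : ∀ {d} (f : Aff d) fs x → All (λ g → eval g x ≤ mx f fs x) (f ∷ fs)
  mx-ub f []       x = ≤-refl ∷ []
  mx-ub f (g ∷ gs) x with mx-ub f gs x
  ... | f≤ ∷ gs≤ = ≤-trans f≤ (x≤y⊔x _ _) ∷ x≤x⊔y _ _ ∷ All.map (λ h≤ → ≤-trans h≤ (x≤y⊔x _ _)) gs≤

  mx-lub : ∀ {d} {f : Aff d} {fs x z} → All (λ g → eval g x ≤ z) (f ∷ fs) → mx f fs x ≤ z
  mx-lub {fs = []}     (f≤z ∷ [])        = f≤z
  mx-lub {fs = g ∷ gs} (f≤z ∷ g≤z ∷ gs≤z) = ⊔-lub g≤z (mx-lub (f≤z ∷ gs≤z))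

  mx-sel : ∀ {d} (f : Aff d) fs x → Any (λ g → mx f fs x ≈ eval g x) (f ∷ fs)
  mx-sel f []       x = here refl
  mx-sel f (g ∷ gs) x with ⊔-sel (eval g x) (mx f gs x) | mx-sel f gs x
  ... | inj₁ eq | _         = there (here eq)
  ... | inj₂ eq | here eq′  = here (trans eq eq′)
  ... | inj₂ eq | there sel = there (there (Any.map (trans eq) sel))

  mx-↭ : ∀ {d} {f g : Aff d} {fs gs} → f ∷ fs ↭ g ∷ gs → ∀ x → mx f fs x ≈ mx g gs x
  mx-↭ {f = f} {g} {fs} {gs} f∷fs↭g∷gs x = antisym
    (mx-lub (All-resp-↭ (↭-sym f∷fs↭g∷gs) (mx-ub g gs x)))
    (mx-lub (All-resp-↭ f∷fs↭g∷gs (mx-ub f fs x)))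

  continuous-mx : ∀ {d} (f : Aff d) fs → Continuous (mx f fs)
  continuous-mx f []       = continuous-eval f
  continuous-mx f (g ∷ gs) = continuous-⊔ (continuous-eval g) (continuous-mx f gs)

  IsMax : ∀ {d} → (ℝ^ d → Carrier) → Set
  IsMax φ = ∃[ f ] ∃[ fs ] (∀ x → φ x ≈ mx f fs x)

  isMax-≈ : ∀ {d} {φ χ : ℝ^ d → Carrier} → (∀ x → φ x ≈ χ x) → IsMax χ → IsMax φ
  isMax-≈ φ≈χ (f , fs , χ≈mx) = f , fs , λ x → trans (φ≈χ x) (χ≈mx x)

  isMax-⊔ : ∀ {d} {φ χ : ℝ^ d → Carrier} → IsMax φ → IsMax χ → IsMax (λ x → φ x ⊔ χ x)
  isMax-⊔ (f , fs , φ≈mx) (g , gs , χ≈mx) =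
    g , fs List.++ f ∷ gs , λ x → trans (⊔-cong (φ≈mx x) (χ≈mx x)) (mx-++ fs x)
    where
    mx-++ : ∀ fs x → mx f fs x ⊔ mx g gs x ≈ mx g (fs List.++ f ∷ gs) x
    mx-++ []       x = refl
    mx-++ (h ∷ fs) x = trans (⊔-assoc _ _ _) (⊔-cong refl (mx-++ fs x))

  +-distribʳ-⊔ : ∀ x y z → (x ⊔ y) + z ≈ (x + z) ⊔ (y + z)
  +-distribʳ-⊔ x y z = mono-≤-distrib-⊔ +-congʳ (+-monoˡ-≤ z) x y

  isMax-eval+mx : ∀ {d} (f g : Aff d) gs → IsMax (λ x → eval f x + mx g gs x)
  isMax-eval+mx f g []       = f ⊕[ 1# ] g , [] , λ x → sym (trans (eval-⊕ f 1# g x)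
    (solve 2 (λ a b → a :+ con (+ 1) :* b := a :+ b) refl (eval f x) (eval g x)))
  isMax-eval+mx f g (h ∷ gs) =
    isMax-≈ (λ x → trans (+-comm _ _) (trans (+-distribʳ-⊔ _ _ _) (⊔-cong (+-comm _ _) (+-comm _ _))))
      (isMax-⊔ (isMax-eval+mx f h []) (isMax-eval+mx f g gs))

  -- Addition distributes over `⊔`, so the pieces of the sum are all the pairwise sums.
  isMax-mx+mx : ∀ {d} (f : Aff d) fs g gs → IsMax (λ x → mx f fs x + mx g gs x)
  isMax-mx+mx f []       g gs = isMax-eval+mx f g gs
  isMax-mx+mx f (h ∷ fs) g gs = isMax-≈ (λ x → +-distribʳ-⊔ _ _ _)
    (isMax-⊔ (isMax-eval+mx h g gs) (isMax-mx+mx f fs g gs))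

  isMax-+ : ∀ {d} {φ χ : ℝ^ d → Carrier} → IsMax φ → IsMax χ → IsMax (λ x → φ x + χ x)
  isMax-+ (f , fs , φ≈mx) (g , gs , χ≈mx) =
    isMax-≈ (λ x → +-cong (φ≈mx x) (χ≈mx x)) (isMax-mx+mx f fs g gs)

  -- Differences of two maxima and their closure under lattice operations

  IsDifferenceOfMax : ∀ {d} → (ℝ^ d → Carrier) → Set
  IsDifferenceOfMax {d} φ = ∃[ F ] ∃[ G ] IsMax {d} F × IsMax {d} G × (∀ x → φ x ≈ F x - G x)

  dm-eval : ∀ {d} (f : Aff d) → IsDifferenceOfMax (eval f)
  -- The function is written as twice itself minus itself, so both terms are single pieces built
  -- from `f`.
  dm-eval f = eval (f ⊕[ 1# ] f) , eval f , (f ⊕[ 1# ] f , [] , λ _ → refl) , (f , [] , λ _ → refl) ,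
    λ x → sym (trans (+-congʳ (eval-⊕ f 1# f x))
      (solve 1 (λ a → a :+ con (+ 1) :* a :- a := a) refl (eval f x)))

  dm-neg : ∀ {d} {φ : ℝ^ d → Carrier} → IsDifferenceOfMax φ → IsDifferenceOfMax (λ x → - φ x)
  dm-neg (F , G , maxF , maxG , φ≈) = G , F , maxG , maxF , λ x →
    trans (-‿cong (φ≈ x)) (solve 2 (λ a b → :- (a :- b) := b :- a) refl (F x) (G x))

  -- Both differences are brought to the common subtrahend `G + K`, which then moves out of the
  -- maximum.
  dm-⊔ : ∀ {d} {φ χ : ℝ^ d → Carrier} →
         IsDifferenceOfMax φ → IsDifferenceOfMax χ → IsDifferenceOfMax (λ x → φ x ⊔ χ x)
  dm-⊔ {φ = φ} {χ} (F , G , maxF , maxG , φ≈) (H , K , maxH , maxK , χ≈) =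
    (λ x → (F x + K x) ⊔ (H x + G x)) , (λ x → G x + K x) ,
    isMax-⊔ (isMax-+ maxF maxK) (isMax-+ maxH maxG) , isMax-+ maxG maxK , λ x → begin-equality
      φ x ⊔ χ x
        ≈⟨ ⊔-cong
             (trans (φ≈ x) (solve 3 (λ f g k → f :- g := f :+ k :- (g :+ k)) refl (F x) (G x) (K x)))
             (trans (χ≈ x) (solve 3 (λ h g k → h :- k := h :+ g :- (g :+ k)) refl (H x) (G x) (K x))) ⟩
      (F x + K x - (G x + K x)) ⊔ (H x + G x - (G x + K x))
        ≈⟨ +-distribʳ-⊔ _ _ _ ⟨
      ((F x + K x) ⊔ (H x + G x)) - (G x + K x) ∎

  -- Minima are written through negation and `⊔`, so that `dm-neg` and `dm-⊔` apply to them
  -- directly.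
  mn : ∀ {d} → Aff d → List (Aff d) → ℝ^ d → Carrier
  mn f []       x = eval f x
  mn f (g ∷ gs) x = - (- eval g x ⊔ - mn f gs x)

  -[-x⊔-y]≤x : ∀ x y → - (- x ⊔ - y) ≤ x
  -[-x⊔-y]≤x x y = ≤-respʳ (solve 1 (λ x → :- (:- x) := x) refl x) (neg-mono-≤ (x≤x⊔y (- x) (- y)))

  -[-x⊔-y]≤y : ∀ x y → - (- x ⊔ - y) ≤ y
  -[-x⊔-y]≤y x y = ≤-respʳ (solve 1 (λ x → :- (:- x) := x) refl y) (neg-mono-≤ (x≤y⊔x (- x) (- y)))

  mn-lb : ∀ {d} (f : Aff d) fs x → All (λ g → mn f fs x ≤ eval g x) (f ∷ fs)
  mn-lb f []       x = ≤-refl ∷ []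
  mn-lb f (g ∷ gs) x with mn-lb f gs x
  ... | ≤f ∷ ≤gs = ≤-trans (-[-x⊔-y]≤y _ _) ≤f ∷ -[-x⊔-y]≤x _ _
                 ∷ All.map (≤-trans (-[-x⊔-y]≤y _ _)) ≤gs

  mn-glb : ∀ {d} {f : Aff d} {fs x z} → All (λ g → z ≤ eval g x) (f ∷ fs) → z ≤ mn f fs x
  mn-glb {fs = []}             (z≤f ∷ [])         = z≤f
  mn-glb {fs = g ∷ gs} {z = z} (z≤f ∷ z≤g ∷ z≤gs) =
    ≤-respˡ (solve 1 (λ x → :- (:- x) := x) refl z)
      (neg-mono-≤ (⊔-lub (neg-mono-≤ z≤g) (neg-mono-≤ (mn-glb (z≤f ∷ z≤gs)))))

  dm-mn : ∀ {d} (f : Aff d) fs → IsDifferenceOfMax (mn f fs)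
  dm-mn f []       = dm-eval f
  dm-mn f (g ∷ gs) = dm-neg (dm-⊔ (dm-neg (dm-eval g)) (dm-neg (dm-mn f gs)))

  -- The max-min representation

  sublists : ∀ {A : Set} → List A → List (List A)
  sublists []       = [] ∷ []
  sublists (x ∷ xs) = List.map (x ∷_) (sublists xs) List.++ sublists xs

  -- The set of pieces that dominate `φ` at a point varies with the point, but being a filter of
  -- `fs` it ranges over a finite list. This makes the outer maximum finite.
  filter-∈-sublists : ∀ {A : Set} {P : Pred A 0ℓ} (P? : Decidable P) xs → List.filter P? xs ∈ sublists xs
  filter-∈-sublists P? []       = here ≡.refl
  filter-∈-sublists P? (x ∷ xs) with does (P? x)
  ... | true  = ∈-++⁺ˡ (∈-map⁺ (x ∷_) (filter-∈-sublists P? xs))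
  ... | false = ∈-++⁺ʳ _ (filter-∈-sublists P? xs)

  -- φ is the maximum, over the sets S of pieces with min S ≤ φ, of min S.
  module MaxMin {d} (φ : ℝ^ d → Carrier) (fs : List (Aff d))
                (crossing : ∀ x y → Any (λ f → eval f x ≤ φ x × φ y ≤ eval f y) fs) where

    Minorant : List (Aff d) → Set
    Minorant S = ∀ x → Any (λ f → eval f x ≤ φ x) S

    Dominates : ℝ^ d → List (Aff d) → Set
    Dominates y S = All (λ f → φ y ≤ eval f y) S

    minimum : ∀ S → Minorant S → ∃[ m ] IsDifferenceOfMax m × (∀ x → m x ≤ φ x) ×
                                        (∀ y → Dominates y S → φ y ≤ m y)
    -- The empty set of pieces is no minorant, because there is at least one point to test it at:
    -- the origin.
    minimum []       minorant with () ← minorant (λ _ → 0#)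
    minimum (f ∷ fs) minorant = mn f fs , dm-mn f fs ,
      (λ x → let _ , g∈ , gx≤φx = find (minorant x) in ≤-trans (All.lookup (mn-lb f fs x) g∈) gx≤φx) ,
      λ _ → mn-glb

    maximum : ∀ {S₀} → Minorant S₀ → ∀ Ss → All Minorant Ss →
              ∃[ M ] IsDifferenceOfMax M × (∀ x → M x ≤ φ x) × (∀ y → Any (Dominates y) Ss → φ y ≤ M y)
    -- An empty maximum has no value, so the minimum of a known minorant `S₀` is the starting value;
    -- it lies below `φ` and so respects the upper bound.
    maximum {S₀} min₀ [] [] = let m , dm , m≤φ , _ = minimum S₀ min₀ in m , dm , m≤φ , λ _ ()
    maximum min₀ (S ∷ Ss) (minS ∷ minSs) =
      let m , dm-m , m≤φ , φ≤m = minimum S minS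
          M , dm-M , M≤φ , φ≤M = maximum min₀ Ss minSs
      in (λ x → m x ⊔ M x) , dm-⊔ dm-m dm-M , (λ x → ⊔-lub (m≤φ x) (M≤φ x)) , λ where
        y (here dom)  → ≤-trans (φ≤m y dom) (x≤x⊔y (m y) (M y))
        y (there dom) → ≤-trans (φ≤M y dom) (x≤y⊔x (m y) (M y))

    dominators : ℝ^ d → List (Aff d)
    dominators y = List.filter (λ f → em {φ y ≤ eval f y}) fs

    dominators-minorant : ∀ y → Minorant (dominators y)
    dominators-minorant y x =
      let f , f∈fs , fx≤φx , φy≤fy = find (crossing x y)
      in lose (∈-filter⁺ (λ f → em {φ y ≤ eval f y}) f∈fs φy≤fy) fx≤φx

    isDifferenceOfMax : ∃[ M ] IsDifferenceOfMax M × (∀ x → φ x ≈ M x)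
    isDifferenceOfMax =
      let minorant?          = λ S → em {Minorant S}
          M , dm , M≤φ , φ≤M = maximum (dominators-minorant (λ _ → 0#))
            (List.filter minorant? (sublists fs)) (all-filter minorant? (sublists fs))
      in M , dm , λ x → antisym
        (φ≤M x (lose
          (∈-filter⁺ minorant? (filter-∈-sublists (λ f → em {φ x ≤ eval f x}) fs) (dominators-minorant x))
          (all-filter (λ f → em {φ x ≤ eval f x}) fs)))
        (M≤φ x)

  -- Sums and elimination

  sum-neg : ∀ {n} (t : Vector Carrier n) → sum (λ i → - t i) ≈ - sum t
  sum-neg {zero}  t = solve 0 (con (+ 0) := :- con (+ 0)) refl
  sum-neg {suc n} t = trans (+-congˡ (sum-neg (t ∘ suc)))
    (solve 2 (λ a b → (:- a) :+ (:- b) := :- (a :+ b)) refl (t zero) (sum (t ∘ suc)))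

  sum-zero : ∀ {n} {t : Vector Carrier n} → (∀ i → t i ≈ 0#) → sum t ≈ 0#
  sum-zero {n} t≈0 = trans (sum-cong-≋ t≈0) (sum-replicate-zero n)

  ⟨⟩-updateAt : ∀ {d} (b x : ℝ^ d) k s → ⟨ b , Vector.updateAt x k (_+ s) ⟩ ≈ ⟨ b , x ⟩ + b k * s
  ⟨⟩-updateAt {suc d} b x zero s =
    solve 4 (λ b x s y → b :* (x :+ s) :+ y := b :* x :+ y :+ b :* s) refl
      (b zero) (x zero) s ⟨ b ∘ suc , x ∘ suc ⟩
  ⟨⟩-updateAt {suc d} b x (suc k) s = trans (+-congˡ (⟨⟩-updateAt (b ∘ suc) (x ∘ suc) k s))
    (solve 3 (λ a y z → a :+ (y :+ z) := a :+ y :+ z) refl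
      (b zero * x zero) ⟨ b ∘ suc , x ∘ suc ⟩ (b (suc k) * s))

  eval-updateAt : ∀ {d} (f : Aff d) x k s →
                  eval f (Vector.updateAt x k (_+ s)) ≈ eval f x + proj₁ f k * s
  eval-updateAt (b , a) x k s = trans (+-congʳ (⟨⟩-updateAt b x k s))
    (solve 3 (λ x a s → x :+ s :+ a := x :+ a :+ s) refl ⟨ b , x ⟩ a (b k * s))

  -- The combination has to be constant, not zero: this is linear dependence of the linear parts,
  -- expressed through values.
  Dependent : ∀ {d n} → Vector (Aff d) n → Set
  Dependent {n = n} h = Σ[ μ ∈ Vector Carrier n ]
    (∃[ i ] ¬ (μ i ≈ 0#)) × (∃[ c ] (∀ x → sum (λ i → μ i * eval (h i) x) ≈ c))

  CommonZero : ∀ {d n} → Vector (Aff d) n → Set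
  CommonZero h = ∃[ p ] (∀ i → eval (h i) p ≈ 0#)

  -- Gaussian elimination: if h₀ is not constant, subtract multiples of it from
  -- the other hᵢ to make them independent of a coordinate on which h₀ depends.
  dependent-or-commonZero : ∀ {d} n (h : Vector (Aff d) n) → Dependent h ⊎ CommonZero h
  dependent-or-commonZero zero h = inj₂ ((λ _ → 0#) , λ ())
  dependent-or-commonZero {d} (suc n) h with em {∃[ k ] ¬ (proj₁ (h zero) k ≈ 0#)}
  ... | no ¬pivot = inj₁ (μ , (zero , λ 1≈0 → 0≉1 (sym 1≈0)) , proj₂ (h zero) , λ x → begin-equality
    1# * eval (h zero) x + sum (λ i → 0# * eval (h (suc i)) x)
      ≈⟨ +-cong (solve 1 (λ a → con (+ 1) :* a := a) refl (eval (h zero) x))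
                (sum-zero (λ i → zeroˡ (eval (h (suc i)) x))) ⟩
    eval (h zero) x + 0#
      ≈⟨ +-identityʳ _ ⟩
    eval (h zero) x
      ≈⟨ +-congʳ (sum-zero (λ k → trans (*-congʳ (b≈0 k)) (zeroˡ (x k)))) ⟩
    0# + proj₂ (h zero)
      ≈⟨ +-identityˡ _ ⟩
    proj₂ (h zero) ∎)
    where
    b≈0 : ∀ k → proj₁ (h zero) k ≈ 0#
    b≈0 k with em {proj₁ (h zero) k ≈ 0#}
    ... | yes bₖ≈0 = bₖ≈0
    ... | no bₖ≉0  = contradiction (k , bₖ≉0) ¬pivot

    μ : Vector Carrier (suc n)
    μ zero    = 1#
    μ (suc i) = 0#
  ... | yes (k , m≉0) with inverse (proj₁ (h zero) k) m≉0
  ...   | m⁻¹ , mm⁻¹≈1 with dependent-or-commonZero n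
                              (λ i → h (suc i) ⊕[ - (proj₁ (h (suc i)) k * m⁻¹) ] h zero)
  -- A dependence among the reduced functions pulls back: the weight of `h zero` collects the
  -- multiples of it that were subtracted.
  ...     | inj₁ (μ , (i , μᵢ≉0) , c , Σ≈c) = inj₁ (μ′ , (suc i , μᵢ≉0) , c , λ x → begin-equality
    sum (λ i → μ i * - r i) * eval (h zero) x + sum (λ i → μ i * eval (h (suc i)) x)
      ≈⟨ +-congʳ (*-distribʳ-sum (eval (h zero) x) (λ i → μ i * - r i)) ⟩
    sum (λ i → μ i * - r i * eval (h zero) x) + sum (λ i → μ i * eval (h (suc i)) x)
      ≈⟨ ∑-distrib-+ (λ i → μ i * - r i * eval (h zero) x) (λ i → μ i * eval (h (suc i)) x) ⟨
    sum (λ i → μ i * - r i * eval (h zero) x + μ i * eval (h (suc i)) x)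
      ≈⟨ sum-cong-≋ (λ i → trans
           (solve 4 (λ μ s a b → μ :* s :* a :+ μ :* b := μ :* (b :+ s :* a)) refl
             (μ i) (- r i) (eval (h zero) x) (eval (h (suc i)) x))
           (*-congˡ (sym (eval-⊕ (h (suc i)) (- r i) (h zero) x)))) ⟩
    sum (λ i → μ i * eval (h (suc i) ⊕[ - r i ] h zero) x)
      ≈⟨ Σ≈c x ⟩
    c ∎)
    where
    r : Vector Carrier n
    r i = proj₁ (h (suc i)) k * m⁻¹

    μ′ : Vector Carrier (suc n)
    μ′ zero    = sum (λ i → μ i * - r i)
    μ′ (suc i) = μ i
  -- Shifting coordinate `k` by `s` makes `h zero` vanish. It changes each other function by exactly
  -- the multiple of `h zero` subtracted in the reduction, so the value at `p′` is the reduced value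
  -- at `p`.
  ...     | inj₂ (p , hp≈0) = inj₂ (p′ , zero-at)
    where
    s : Carrier
    s = - (m⁻¹ * eval (h zero) p)

    p′ : ℝ^ d
    p′ = Vector.updateAt p k (_+ s)

    zero-at : ∀ i → eval (h i) p′ ≈ 0#
    zero-at zero    = begin-equality
      eval (h zero) p′
        ≈⟨ eval-updateAt (h zero) p k s ⟩
      eval (h zero) p + proj₁ (h zero) k * s
        ≈⟨ solve 3 (λ e m m⁻¹ → e :+ m :* (:- (m⁻¹ :* e)) := (con (+ 1) :- m :* m⁻¹) :* e) refl
             (eval (h zero) p) (proj₁ (h zero) k) m⁻¹ ⟩
      (1# - proj₁ (h zero) k * m⁻¹) * eval (h zero) p
        ≈⟨ *-congʳ (trans (+-congˡ (-‿cong mm⁻¹≈1)) (-‿inverseʳ 1#)) ⟩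
      0# * eval (h zero) p
        ≈⟨ zeroˡ _ ⟩
      0# ∎
    zero-at (suc i) = begin-equality
      eval (h (suc i)) p′
        ≈⟨ eval-updateAt (h (suc i)) p k s ⟩
      eval (h (suc i)) p + proj₁ (h (suc i)) k * s
        ≈⟨ solve 4 (λ e e₀ b m⁻¹ → e :+ b :* (:- (m⁻¹ :* e₀)) := e :+ (:- (b :* m⁻¹)) :* e₀) refl
             (eval (h (suc i)) p) (eval (h zero) p) (proj₁ (h (suc i)) k) m⁻¹ ⟩
      eval (h (suc i)) p + - (proj₁ (h (suc i)) k * m⁻¹) * eval (h zero) p
        ≈⟨ eval-⊕ (h (suc i)) _ (h zero) p ⟨
      eval (h (suc i) ⊕[ - (proj₁ (h (suc i)) k * m⁻¹) ] h zero) p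
        ≈⟨ hp≈0 i ⟩
      0# ∎

  -- Linear combinations of conewise linear functions

  -- The translated cones double as the polyhedra of the piecewise-linear structure: a half-space
  -- with normal `b` and apex `p` is the one with bound `⟨ b , p ⟩`.
  conewiseLinear : ∀ {d} {φ : ℝ^ d → Carrier} → Continuous φ → ∀ p Cs →
                   (∀ x → Any (λ C → x ∈ p +ᶜ C) Cs) →
                   All (λ C → AffineOn (λ x → x ∈ p +ᶜ C) φ) Cs → ConewiseLinear φ
  conewiseLinear {d} cont p Cs cover affine =
    (cont , List.map polyhedron Cs ,
      (λ x → Any-map⁺ (Any.map (λ x∈C → All-map⁺ (All.map (to _ x) x∈C)) (cover x))) ,
      All-map⁺ (All.map
        (λ (b , a , φ≈) → b , a , λ x x∈P → φ≈ x (All.map (from _ x) (All-map⁻ x∈P))) affine)) ,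
    p , Cs , cover , affine
    where
    polyhedron : Cone d → Polyhedron d
    polyhedron = List.map (λ b → b , ⟨ b , p ⟩)

    to : ∀ b x → ⟨ b , zipWith _-_ x p ⟩ ≤ 0# → ⟨ b , x ⟩ ≤ ⟨ b , p ⟩
    to b x ≤0 = ≤-by (0≤-x (≤-respˡ (⟨⟩-subʳ b x p) ≤0))
      (solve 2 (λ u v → v :- u := :- (u :- v)) refl ⟨ b , x ⟩ ⟨ b , p ⟩)

    from : ∀ b x → ⟨ b , x ⟩ ≤ ⟨ b , p ⟩ → ⟨ b , zipWith _-_ x p ⟩ ≤ 0#
    from b x x≤p = ≤-respˡ (sym (⟨⟩-subʳ b x p)) (≤-by (x≤y⇒0≤y-x x≤p)
      (solve 2 (λ u v → con (+ 0) :- (u :- v) := v :- u) refl ⟨ b , x ⟩ ⟨ b , p ⟩))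

  -- The cone of `g` is the region where `g` attains the maximum. As all pieces agree at `p`, each
  -- `h - g` is linear in `x - p`, so homogeneous inequalities cut this region out.
  conewiseLinear-mx : ∀ {d} (f : Aff d) fs p → All (λ g → eval g p ≈ eval f p) fs →
                      ConewiseLinear (mx f fs)
  conewiseLinear-mx {d} f fs p agree = conewiseLinear (continuous-mx f fs) p (List.map cone pieces)
    (λ x → let g , g∈ , mx≈g = find (mx-sel f fs x) in
      lose (∈-map⁺ cone g∈) (All-map⁺ (All.tabulate λ {h} h∈ → ≤-respˡ (sym (normal g∈ h∈ x))
        (≤-by (x≤y⇒0≤y-x (≤-respʳ mx≈g (All.lookup (mx-ub f fs x) h∈)))
          (solve 2 (λ h g → con (+ 0) :- (h :- g) := g :- h) refl (eval h x) (eval g x))))))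
    (All-map⁺ (All.tabulate λ {g} g∈ → proj₁ g , proj₂ g , λ x x∈C → antisym
      (mx-lub (All.tabulate λ {h} h∈ →
        ≤-by (0≤-x (≤-respˡ (normal g∈ h∈ x) (All.lookup (All-map⁻ x∈C) h∈)))
          (solve 2 (λ h g → g :- h := :- (h :- g)) refl (eval h x) (eval g x))))
      (All.lookup (mx-ub f fs x) g∈)))
    where
    pieces : List (Aff d)
    pieces = f ∷ fs

    cone : Aff d → Cone d
    cone g = List.map (λ h → proj₁ (h ⊕[ - 1# ] g)) pieces

    agree′ : All (λ g → eval g p ≈ eval f p) pieces
    agree′ = refl ∷ agree

    normal : ∀ {g h} → g ∈ pieces → h ∈ pieces → ∀ x →
             ⟨ proj₁ (h ⊕[ - 1# ] g) , zipWith _-_ x p ⟩ ≈ eval h x - eval g x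
    normal {g} {h} g∈ h∈ x = begin-equality
      ⟨ proj₁ h-g , zipWith _-_ x p ⟩
        ≈⟨ ⟨⟩-subʳ (proj₁ h-g) x p ⟩
      ⟨ proj₁ h-g , x ⟩ - ⟨ proj₁ h-g , p ⟩
        ≈⟨ solve 3 (λ x p a → x :- p := x :+ a :- (p :+ a)) refl
             ⟨ proj₁ h-g , x ⟩ ⟨ proj₁ h-g , p ⟩ (proj₂ h-g) ⟩
      eval h-g x - eval h-g p
        ≈⟨ +-cong (eval-⊕ h (- 1#) g x) (-‿cong (eval-⊕ h (- 1#) g p)) ⟩
      eval h x + - 1# * eval g x - (eval h p + - 1# * eval g p)
        ≈⟨ +-congˡ (-‿cong (+-cong (All.lookup agree′ h∈) (*-congˡ (All.lookup agree′ g∈)))) ⟩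
      eval h x + - 1# * eval g x - (eval f p + - 1# * eval f p)
        ≈⟨ solve 3 (λ h g v → h :+ (:- con (+ 1)) :* g :- (v :+ (:- con (+ 1)) :* v) := h :- g) refl
             (eval h x) (eval g x) (eval f p) ⟩
      eval h x - eval g x ∎
      where
      h-g : Aff d
      h-g = h ⊕[ - 1# ] g

  -- Linear combinations in list form. Each constructor carries an equation because functions are
  -- compared pointwise.
  data Span {d} (φ : ℝ^ d → Carrier) : Set where
    null : (∀ x → φ x ≈ 0#) → Span φ
    cons : ∀ c {ψ χ} → ConewiseLinear ψ → Span χ → (∀ x → φ x ≈ c * ψ x + χ x) → Span φ

  span-≈ : ∀ {d} {φ χ : ℝ^ d → Carrier} → (∀ x → φ x ≈ χ x) → Span χ → Span φ
  span-≈ φ≈χ (null χ≈0)           = null λ x → trans (φ≈χ x) (χ≈0 x)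
  span-≈ φ≈χ (cons c cwl span χ≈) = cons c cwl span λ x → trans (φ≈χ x) (χ≈ x)

  -- Subtraction is the operation that both inclusion-exclusion and the difference of two maxima
  -- call for. Terms of `φ` are copied first, then those of `χ` with negated coefficients.
  span-- : ∀ {d} {φ χ : ℝ^ d → Carrier} → Span φ → Span χ → Span (λ x → φ x - χ x)
  span-- {φ = φ} {χ} (cons c {ψ} {ρ} cwl span φ≈) span′ =
    cons c cwl (span-- span span′) λ x → trans (+-congʳ (φ≈ x))
      (solve 4 (λ c p r x → c :* p :+ r :- x := c :* p :+ (r :- x)) refl c (ψ x) (ρ x) (χ x))
  span-- (null φ≈0) (null χ≈0) =
    null λ x → trans (+-cong (φ≈0 x) (-‿cong (χ≈0 x))) (-‿inverseʳ 0#)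
  span-- {φ = φ} {χ} (null φ≈0) (cons c {ψ} {ρ} cwl span χ≈) =
    cons (- c) cwl (span-- (null φ≈0) span) λ x → trans (+-congˡ (-‿cong (χ≈ x)))
      (solve 4 (λ f c p r → f :- (c :* p :+ r) := (:- c) :* p :+ (f :- r)) refl (φ x) c (ψ x) (ρ x))

  span-conewise : ∀ {d} {ψ : ℝ^ d → Carrier} → ConewiseLinear ψ → Span ψ
  span-conewise {ψ = ψ} cwl = cons 1# cwl (null {φ = λ _ → 0#} λ _ → refl)
    λ x → solve 1 (λ p → p := con (+ 1) :* p :+ con (+ 0)) refl (ψ x)

  span⇒linearCombination : ∀ {d} {φ : ℝ^ d → Carrier} → Span φ →
    ∃[ n ] ∃[ c ] ∃[ ψ ] (∀ i → ConewiseLinear (ψ i)) × IsLinearCombination {d} {n} φ c ψ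
  span⇒linearCombination (null φ≈0) = 0 , (λ ()) , (λ ()) , (λ ()) , φ≈0
  span⇒linearCombination (cons c {ψ} cwl span φ≈) =
    let n , cs , ψs , cwls , χ≈ = span⇒linearCombination span in
    suc n , c Vector.∷ cs , ψ Vector.∷ ψs , (λ { zero → cwl ; (suc i) → cwls i }) ,
    λ x → trans (φ≈ x) (+-congˡ (χ≈ x))

  -- Inclusion-exclusion: the sum of (-1)^|S| max ({f} ∪ T ∪ S) over all S ⊆ L.
  alternating : ∀ {d} → Aff d → List (Aff d) → List (Aff d) → ℝ^ d → Carrier
  alternating f T []      x = mx f T x
  alternating f T (g ∷ L) x = alternating f T L x - alternating f (g ∷ T) L x

  alternating-cong : ∀ {d} (f : Aff d) {T T′} L {x} → mx f T x ≈ mx f T′ x →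
                     alternating f T L x ≈ alternating f T′ L x
  alternating-cong f []      eq = eq
  alternating-cong f (g ∷ L) eq =
    +-cong (alternating-cong f L eq) (-‿cong (alternating-cong f L (⊔-cong refl eq)))

  -- A piece that is already at most the maximum over `T` changes no maximum it joins, so the terms
  -- with and without it cancel.
  alternating≈0 : ∀ {d} {f : Aff d} {T L x} → Any (λ g → eval g x ≤ mx f T x) L →
                  alternating f T L x ≈ 0#
  alternating≈0 {f = f} {L = g ∷ L} (here g≤) =
    trans (+-congˡ (-‿cong (alternating-cong f L (x≤y⇒x⊔y≈y g≤)))) (-‿inverseʳ _)
  alternating≈0 (there g≤) = trans
    (+-cong (alternating≈0 g≤) (-‿cong (alternating≈0 (Any.map (λ h≤ → ≤-trans h≤ (x≤y⊔x _ _)) g≤))))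
    (-‿inverseʳ 0#)

  module _ {d} (N : ℕ) (shorter : ∀ (f : Aff d) fs → List.length fs ℕ.< N → Span (mx f fs)) where

    span-alternating : ∀ f T L → List.length L ℕ.+ List.length T ℕ.< N → Span (alternating f T L)
    span-alternating f T []      ∣T∣<N   = shorter f T ∣T∣<N
    span-alternating f T (g ∷ L) ∣LT∣<N = span--
      (span-alternating f T L (ℕₚ.<-trans (ℕₚ.n<1+n _) ∣LT∣<N))
      (span-alternating f (g ∷ T) L (≡.subst (ℕ._< N) (≡.sym (ℕₚ.+-suc _ _)) ∣LT∣<N))

    -- All terms of the alternating sum but the one for S = L have at most N pieces.
    span-mx-from-alternating : ∀ f T L → List.length L ℕ.+ List.length T ℕ.≤ N →
                               Span (alternating f T L) → Span (mx f (L ʳ++ T))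
    span-mx-from-alternating f T []      ∣LT∣≤N span = span
    -- The half of the sum without `g` has only shorter maxima and is subtracted away; the half with
    -- `g` in `T` goes on. Pieces pile up on `T` in reverse, whence `ʳ++`.
    span-mx-from-alternating f T (g ∷ L) ∣LT∣≤N span = span-mx-from-alternating f (g ∷ T) L
      (≡.subst (ℕ._≤ N) (≡.sym (ℕₚ.+-suc _ _)) ∣LT∣≤N)
      (span-≈ (λ x → solve 2 (λ a b → b := a :- (a :- b)) refl
          (alternating f T L x) (alternating f (g ∷ T) L x))
        (span-- (span-alternating f T L ∣LT∣≤N) span))

  -- Induction on the number of pieces

  split : ∀ {A : Set} (P : Pred A 0ℓ) (xs : List A) →
          ∃[ ys ] ∃[ zs ] xs ↭ ys List.++ zs × All P ys × All (λ x → ¬ P x) zs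
  split P []       = [] , [] , ↭-refl , [] , []
  split P (x ∷ xs) with em {P x} | split P xs
  ... | yes Px | ys , zs , xs↭ , Pys , ¬Pzs = x ∷ ys , zs , prep x xs↭ , Px ∷ Pys , ¬Pzs
  ... | no ¬Px | ys , zs , xs↭ , Pys , ¬Pzs =
    ys , x ∷ zs , ↭-trans (prep x xs↭) (↭-sym (shift x ys zs)) , Pys , ¬Px ∷ ¬Pzs

  -- Given ∑ wᵢ = 0 and ∑ wᵢ fᵢ = c ≤ 0, no point has fᵢ > max { fⱼ | wⱼ ≤ 0 } for
  -- all i with wᵢ > 0, so the alternating sum over L = { fᵢ | wᵢ > 0 } vanishes.
  span-mx-dependent : ∀ {d} (f : Aff d) fs →
    (∀ (g : Aff d) gs → List.length gs ℕ.< List.length fs → Span (mx g gs)) →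
    (w : Vector Carrier (suc (List.length fs))) → sum w ≈ 0# → (∃[ i ] ¬ (w i ≈ 0#)) →
    ∀ c → c ≤ 0# → (∀ x → sum (λ i → w i * eval (List.lookup (f ∷ fs) i) x) ≈ c) → Span (mx f fs)
  span-mx-dependent {d} f fs shorter w Σw≈0 (k , wₖ≉0) c c≤0 Σwf≈c =
    conclude (split (λ i → 0# < w i) (List.allFin (suc (List.length fs))))
    where
    piece : Fin (suc (List.length fs)) → Aff d
    piece = List.lookup (f ∷ fs)

    pieces↭ : ∀ {is} → List.allFin (suc (List.length fs)) ↭ is → f ∷ fs ↭ List.map piece is
    pieces↭ perm = ↭-trans
      (↭-reflexive (≡.sym (≡.trans (map-tabulate id piece) (tabulate-lookup (f ∷ fs)))))
      (↭-map⁺ piece perm)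

    some-pos : ¬ (∀ i → ¬ (0# < w i))
    some-pos w≤0 = proj₂
      (sum-pos (λ i → - w i) (λ i → 0≤-x (≮⇒≥ (w≤0 i))) k (0<-x (≮⇒≥ (w≤0 k) , wₖ≉0)))
      (sym (trans (sum-neg w) (trans (-‿cong Σw≈0) (solve 0 (:- con (+ 0) := con (+ 0)) refl))))

    some-nonPos : ¬ (∀ i → 0# < w i)
    some-nonPos w>0 = proj₂ (sum-pos w (λ i → <⇒≤ (w>0 i)) k (w>0 k)) (sym Σw≈0)

    conclude : ∃[ ps ] ∃[ ns ] List.allFin (suc (List.length fs)) ↭ ps List.++ ns ×
               All (λ i → 0# < w i) ps × All (λ i → ¬ (0# < w i)) ns → Span (mx f fs)
    conclude ([] , ns , perm , _ , w≤0) =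
      contradiction (λ i → All.lookup w≤0 (∈-resp-↭ perm (∈-allFin i))) some-pos
    conclude (ps@(_ ∷ _) , [] , perm , w>0 , _) = contradiction
      (λ i → All.lookup (++⁺ w>0 []) (∈-resp-↭ perm (∈-allFin i))) some-nonPos
    -- Both signs occur because the weights sum to zero and are not all zero. `n₀` supplies the head
    -- of the maximum over nonpositive weights, `p₀` a strictly positive term in the estimate below.
    conclude (p₀ ∷ ps , n₀ ∷ ns , perm , w>0 , w≤0) = span-≈ (mx-↭ perm′)
      (span-mx-from-alternating (List.length fs) shorter t T L lengths
        (null λ x → alternating≈0 (crossing x)))
      where
      t : Aff d
      t = piece n₀

      T L : List (Aff d)
      T = List.map piece ns
      L = List.map piece (p₀ ∷ ps)

      LT↭ : f ∷ fs ↭ t ∷ L List.++ T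
      LT↭ = ↭-trans (pieces↭ perm) (↭-trans
        (↭-reflexive (map-++ piece (p₀ ∷ ps) (n₀ ∷ ns))) (shift t L T))

      perm′ : f ∷ fs ↭ t ∷ (L ʳ++ T)
      perm′ = ↭-trans LT↭ (prep t (++↭ʳ++ L T))

      lengths : List.length L ℕ.+ List.length T ℕ.≤ List.length fs
      lengths = ℕₚ.≤-reflexive (≡.sym (≡.trans (ℕₚ.suc-injective (↭-length LT↭)) (length-++ L)))

      crossing : ∀ x → Any (λ g → eval g x ≤ mx t T x) L
      crossing x with em {Any (λ g → eval g x ≤ mx t T x) L}
      ... | yes any = any
      -- If all of `L` exceeded `M`, every `w i * (eval (piece i) x - M)` would be nonnegative and
      -- the one at `p₀` positive. But `M` drops out as the weights sum to zero, so the total is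
      -- `c`.
      ... | no ¬any = contradiction c≤0 (<⇒≱ (<-respʳ-≈ Σ≈c (sum-pos term term-nonNeg p₀ (term-pos (here ≡.refl)))))
        where
        M : Carrier
        M = mx t T x

        term : Vector Carrier (suc (List.length fs))
        term i = w i * (eval (piece i) x - M)

        term-pos : ∀ {i} → i ∈ p₀ ∷ ps → 0# < term i
        term-pos i∈ = *-pos (All.lookup w>0 i∈)
          (x<y⇒0<y-x (≰⇒> (All.lookup (All-map⁻ (¬Any⇒All¬ L ¬any)) i∈)))

        term-nonNeg : ∀ i → 0# ≤ term i
        term-nonNeg i with ∈-++⁻ (p₀ ∷ ps) (∈-resp-↭ perm (∈-allFin i))
        ... | inj₁ i∈ = <⇒≤ (term-pos i∈)
        ... | inj₂ i∈ = ≤-respʳ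
          (solve 3 (λ w e m → (:- w) :* (m :- e) := w :* (e :- m)) refl (w i) (eval (piece i) x) M)
          (*-nonNeg (0≤-x (≮⇒≥ (All.lookup w≤0 i∈)))
            (x≤y⇒0≤y-x (All.lookup (All-map⁻ (mx-ub t T x)) i∈)))

        Σ≈c : sum term ≈ c
        Σ≈c = begin-equality
          sum term
            ≈⟨ sum-cong-≋ (λ i → solve 3 (λ w e m → w :* (e :- m) := w :* e :+ w :* (:- m)) refl
                 (w i) (eval (piece i) x) M) ⟩
          sum (λ i → w i * eval (piece i) x + w i * - M)
            ≈⟨ ∑-distrib-+ (λ i → w i * eval (piece i) x) (λ i → w i * - M) ⟩
          sum (λ i → w i * eval (piece i) x) + sum (λ i → w i * - M)
            ≈⟨ +-cong (Σwf≈c x) (sym (*-distribʳ-sum (- M) w)) ⟩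
          c + sum w * - M
            ≈⟨ +-congˡ (trans (*-congʳ Σw≈0) (zeroˡ (- M))) ⟩
          c + 0#
            ≈⟨ +-identityʳ c ⟩
          c ∎

  -- Elimination is applied to the differences with `f`, whose common zero is a point where all
  -- pieces agree. The bound `n` carries the recursion, since the shorter maxima need not be
  -- sublists of `fs` in order.
  span-mx : ∀ {d} n (f : Aff d) fs → List.length fs ℕ.< n → Span (mx f fs)
  span-mx (suc n) f fs (ℕ.s≤s ∣fs∣≤n)
    with dependent-or-commonZero (List.length fs) (λ i → List.lookup fs i ⊕[ - 1# ] f)
  ... | inj₂ (p , zero-at) = span-conewise (conewiseLinear-mx f fs p (All.tabulate agree))
    where
    agree : ∀ {g} → g ∈ fs → eval g p ≈ eval f p
    agree {g} g∈ = ≡.subst (λ h → eval h p ≈ eval f p) (≡.sym (lookup-index g∈)) (begin-equality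
      eval h p
        ≈⟨ solve 2 (λ h f → h := h :+ (:- con (+ 1)) :* f :+ f) refl (eval h p) (eval f p) ⟩
      eval h p + - 1# * eval f p + eval f p
        ≈⟨ +-congʳ (trans (sym (eval-⊕ h (- 1#) f p)) (zero-at (Any.index g∈))) ⟩
      0# + eval f p
        ≈⟨ +-identityˡ _ ⟩
      eval f p ∎)
      where h = List.lookup fs (Any.index g∈)
  ... | inj₁ (μ , (i , μᵢ≉0) , c , Σ≈c) = by-sign (total c 0#)
    where
    shorter : ∀ g gs → List.length gs ℕ.< List.length fs → Span (mx g gs)
    shorter g gs ∣gs∣<∣fs∣ = span-mx n g gs (ℕₚ.<-≤-trans ∣gs∣<∣fs∣ ∣fs∣≤n)

    w : Vector Carrier (suc (List.length fs))
    -- With this weight the total is zero, and the weighted sum of the pieces equals the dependence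
    -- among the differences with `f`.
    w zero    = - sum μ
    w (suc i) = μ i

    Σw≈0 : sum w ≈ 0#
    Σw≈0 = trans (+-comm _ _) (-‿inverseʳ (sum μ))

    Σwf≈c : ∀ x → sum (λ i → w i * eval (List.lookup (f ∷ fs) i) x) ≈ c
    Σwf≈c x = begin-equality
      - sum μ * eval f x + sum (λ i → μ i * fᵢ i)
        ≈⟨ solve 3 (λ s e t → (:- s) :* e :+ t := t :+ s :* (:- e)) refl
             (sum μ) (eval f x) (sum (λ i → μ i * fᵢ i)) ⟩
      sum (λ i → μ i * fᵢ i) + sum μ * - eval f x
        ≈⟨ +-congˡ (*-distribʳ-sum (- eval f x) μ) ⟩
      sum (λ i → μ i * fᵢ i) + sum (λ i → μ i * - eval f x)
        ≈⟨ ∑-distrib-+ (λ i → μ i * fᵢ i) (λ i → μ i * - eval f x) ⟨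
      sum (λ i → μ i * fᵢ i + μ i * - eval f x)
        ≈⟨ sum-cong-≋ (λ i → trans
             (solve 3 (λ μ e f → μ :* e :+ μ :* (:- f) := μ :* (e :+ (:- con (+ 1)) :* f)) refl
               (μ i) (fᵢ i) (eval f x))
             (*-congˡ (sym (eval-⊕ (List.lookup fs i) (- 1#) f x)))) ⟩
      sum (λ i → μ i * eval (List.lookup fs i ⊕[ - 1# ] f) x)
        ≈⟨ Σ≈c x ⟩
      c ∎
      where
      fᵢ : Vector Carrier (List.length fs)
      fᵢ i = eval (List.lookup fs i) x

    by-sign : c ≤ 0# ⊎ 0# ≤ c → Span (mx f fs)
    by-sign (inj₁ c≤0) = span-mx-dependent f fs shorter w Σw≈0 (suc i , μᵢ≉0) c c≤0 Σwf≈c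
    by-sign (inj₂ 0≤c) = span-mx-dependent f fs shorter (λ i → - w i)
      (trans (sum-neg w) (trans (-‿cong Σw≈0) (solve 0 (:- con (+ 0) := con (+ 0)) refl)))
      (suc i , λ -μᵢ≈0 → μᵢ≉0 (trans (solve 1 (λ m → m := :- (:- m)) refl (μ i))
        (trans (-‿cong -μᵢ≈0) (solve 0 (:- con (+ 0) := con (+ 0)) refl))))
      (- c) (≤-by 0≤c (solve 1 (λ c → con (+ 0) :- (:- c) := c) refl c))
      (λ x → trans (sum-cong-≋ (λ i → solve 2 (λ w e → (:- w) :* e := :- (w :* e)) refl
                      (w i) (eval (List.lookup (f ∷ fs) i) x)))
               (trans (sum-neg (λ i → w i * eval (List.lookup (f ∷ fs) i) x)) (-‿cong (Σwf≈c x))))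

  span-isMax : ∀ {d} {φ : ℝ^ d → Carrier} → IsMax φ → Span φ
  span-isMax (f , fs , φ≈mx) = span-≈ φ≈mx (span-mx _ f fs (ℕₚ.n<1+n _))

  -- Here the polyhedra are forgotten: what remains is that at each point one of finitely many
  -- affine functions gives the value of `φ`.
  pieces : ∀ {d} {φ : ℝ^ d → Carrier} {Ps : List (Polyhedron d)} →
           All (λ P → AffineOn (_∈ₚ P) φ) Ps →
           ∃[ fs ] (∀ x → Any (x ∈ₚ_) Ps → Any (λ f → φ x ≈ eval f x) fs)
  pieces [] = [] , λ _ ()
  pieces ((b , a , φ≈) ∷ affine) =
    let fs , select = pieces affine in (b , a) ∷ fs , λ where
      x (here x∈P)  → here (φ≈ x x∈P)
      x (there x∈P) → there (select x x∈P)

  span-piecewiseLinear : ∀ {d} {φ : ℝ^ d → Carrier} → PiecewiseLinear φ → Span φ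
  span-piecewiseLinear {φ = φ} (cont , Ps , cover , affine) =
    let fs , select = pieces affine
        M , (F , G , maxF , maxG , M≈F-G) , φ≈M =
          MaxMin.isDifferenceOfMax φ fs
            (Selection.crossing φ cont fs (λ x → select x (cover x)))
    in span-≈ (λ x → trans (φ≈M x) (M≈F-G x)) (span-- (span-isMax maxF) (span-isMax maxG))

theorem3 : ExcludedMiddle 0ℓ → (ℝ : RealField) →
    let open RealField ℝ
        open PiecewiseLinearity ℝ in
    ∀ (d : ℕ) (φ : ℝ^ d → Carrier) → PiecewiseLinear φ →
    ∃[ n ] ∃[ c ] ∃[ ψ ]
      (∀ i → ConewiseLinear (ψ i)) × IsLinearCombination {d} {n} φ c ψ
theorem3 em ℝ d φ pwl = span⇒linearCombination (span-piecewiseLinear pwl)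
  where open Decomposition em ℝ
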